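{- Let $n\geq 5$. Suppose (1) every graph in $\mathcal{GAQ}_{n-1}$ is even strongly super matched, and (2) every graph in $\mathcal{GAQ}_{n-1}$ is fractional strongly super matched. Then every graph in $\mathcal{GAQ}_n$ is fractional strongly super matched.
   Context: All graphs are finite, simple, undirected; $G-F$ deletes the vertices and edges of $F\subseteq V(G)\cup E(G)$; $\delta(G)$ is the minimum degree. A perfect matching covers every vertex exactly once; an almost-perfect matching covers all vertices but one exactly once. $F$ is a strong matching preclusion (SMP) set if $G-F$ has neither a perfect nor an almost-perfect matching; $smp(G)$ is the minimum size of an SMP set; an SMP set is optimal if $|F|=smp(G)$. $G$ is strongly maximally matched if $smp(G)=\delta(G)$. An optimal SMP set $F$ is trivial if $G$ has an even number of vertices, $G-F$ has an isolated vertex, and $F$ contains an even number of vertices. $G$ is even strongly super matched if it is strongly maximally matched and every optimal SMP set containing an even number of vertices is trivial. A fractional perfect matching is $f:E(G)\to[0,1]$ with $\sum_{e\ni v}f(e)=1$ for all vertices $v$. $F$ is a fractional strong matching preclusion (FSMP) set if $G-F$ has no fractional perfect matching; $fsmp(G)$ is the minimum size of an FSMP set; an FSMP set is optimal if $|F|=fsmp(G)$. $G$ is fractional strongly maximally matched if $fsmp(G)=\delta(G)$, and fractional strongly super matched if moreover $G-F$ has an isolated vertex for every optimal FSMP set $F$. The augmented cube $AQ_n$: vertices are $n$-bit binary strings; $AQ_1\cong K_2$; for $n\geq2$, take copies $AQ^0_{n-1},AQ^1_{n-1}$ of $AQ_{n-1}$ (prefixes $0$, $1$) and join $0u_1\cdots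 u_{n-1}$ to $1v_1\cdots v_{n-1}$ iff $u_i=v_i$ for all $i$ or $u_i\neq v_i$ for all $i$. $\mathcal{GAQ}_4=\{AQ_4\}$; for $n\geq5$, $\mathcal{GAQ}_n$ consists of all graphs $(V_1\cup V_2,E_1\cup E_2\cup M_1\cup M_2)$ with $(V_1,E_1),(V_2,E_2)\in\mathcal{GAQ}_{n-1}$ on disjoint vertex sets and $M_1,M_2$ edge-disjoint perfect matchings between $V_1$ and $V_2$.
   Formalization: Fractional perfect matchings take rational instead of real values in [0,1], in hypothesis (2) and in the conclusion; since the constraints are linear with 0/1 coefficients, a real solution exists exactly when a rational one does. -}

module Defs where

open import Data.Nat using (ℕ; zero; suc; _+_; _*_; _≤_; _⊓_)
open import Data.Nat.Divisibility using (_∣_)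
open import Data.Bool using (Bool; true; false; _∧_; _∨_; not; if_then_else_)
open import Data.Bool.Properties using (∨-comm)
open import Data.Fin using (Fin; zero; suc; splitAt; opposite; _<?_)
open import Data.Fin.Properties renaming (_≟_ to _≟F_)
open import Data.Sum using (_⊎_; inj₁; inj₂)
open import Data.Product using (Σ; _×_; _,_)
open import Data.Rational using (ℚ; 0ℚ; 1ℚ) renaming (_+_ to _+ℚ_; _≤_ to _≤ℚ_)
open import Relation.Nullary using (¬_; ⌊_⌋)
open import Relation.Binary.PropositionalEquality using (_≡_; _≢_; refl)

record Graph : Set where
  field
    N   : ℕ
    adj : Fin N → Fin N → Bool
    adj-sym : ∀ u v → adj u v ≡ adj v u
    adj-irr : ∀ u → adj u u ≡ false
open Graph public

count : ∀ {N} → (Fin N → Bool) → ℕ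
count {zero}  p = 0
count {suc N} p = (if p zero then 1 else 0) + count (λ i → p (suc i))

sumℕ : ∀ {N} → (Fin N → ℕ) → ℕ
sumℕ {zero}  f = 0
sumℕ {suc N} f = f zero + sumℕ (λ i → f (suc i))

sumℚ : ∀ {N} → (Fin N → ℚ) → ℚ
sumℚ {zero}  f = 0ℚ
sumℚ {suc N} f = f zero +ℚ sumℚ (λ i → f (suc i))

Even : ℕ → Set
Even k = 2 ∣ k

-- minimum of a nonempty list of degrees (default 0 for the empty graph)
min-over : ∀ {N} → (Fin N → ℕ) → ℕ
min-over {zero}        f = 0
min-over {suc zero}    f = f zero
min-over {suc (suc N)} f = f zero ⊓ min-over (λ i → f (suc i))


degree : (G : Graph) → Fin (N G) → ℕ
degree G v = count (λ u → adj G u v)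

δ : Graph → ℕ
δ G = min-over (degree G)

-- A set F ⊆ V(G) ∪ E(G): vdel marks the deleted vertices, and an edge uv
-- of G belongs to F iff edel u v or edel v u.

record DelSet (G : Graph) : Set where
  field
    vdel : Fin (N G) → Bool
    edel : Fin (N G) → Fin (N G) → Bool
open DelSet public

edgeInF : {G : Graph} → DelSet G → Fin (N G) → Fin (N G) → Bool
edgeInF {G} F u v = adj G u v ∧ (edel F u v ∨ edel F v u)

nV : {G : Graph} → DelSet G → ℕ
nV F = count (vdel F)

size : {G : Graph} → DelSet G → ℕ
size {G} F = nV F + sumℕ (λ u → count (λ v → ⌊ u <? v ⌋ ∧ edgeInF F u v))

alive : {G : Graph} → DelSet G → Fin (N G) → Bool
alive F v = not (vdel F v)

edgeH : {G : Graph} → DelSet G → Fin (N G) → Fin (N G) → Bool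
edgeH {G} F u v = alive F u ∧ (alive F v ∧ (adj G u v ∧ not (edel F u v ∨ edel F v u)))

record MatchingOf {G : Graph} (F : DelSet G) : Set where
  field
    m     : Fin (N G) → Fin (N G) → Bool
    m-sym : ∀ u v → m u v ≡ m v u
    m-sub : ∀ u v → m u v ≡ true → edgeH F u v ≡ true
open MatchingOf public

covers : {G : Graph} {F : DelSet G} → MatchingOf F → Fin (N G) → ℕ
covers M v = count (λ u → m M u v)

IsPerfect : {G : Graph} {F : DelSet G} → MatchingOf F → Set
IsPerfect {G} {F} M = ∀ v → alive F v ≡ true → covers M v ≡ 1

IsAlmostPerfect : {G : Graph} {F : DelSet G} → MatchingOf F → Set
IsAlmostPerfect {G} {F} M =
  Σ (Fin (N G)) λ w → alive F w ≡ true × covers M w ≡ 0 ×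
    (∀ v → alive F v ≡ true → v ≢ w → covers M v ≡ 1)

IsSMPSet : (G : Graph) → DelSet G → Set
IsSMPSet G F = ¬ (Σ (MatchingOf F) IsPerfect) × ¬ (Σ (MatchingOf F) IsAlmostPerfect)

SmpIs : Graph → ℕ → Set
SmpIs G k = Σ (DelSet G) (λ F → IsSMPSet G F × size F ≡ k)
          × (∀ F → IsSMPSet G F → k ≤ size F)

OptimalSMP : (G : Graph) → DelSet G → Set
OptimalSMP G F = IsSMPSet G F × (∀ F' → IsSMPSet G F' → size F ≤ size F')

HasIsolated : {G : Graph} → DelSet G → Set
HasIsolated {G} F = Σ (Fin (N G)) λ v → alive F v ≡ true × (∀ u → edgeH F u v ≡ false)

TrivialSMP : (G : Graph) → DelSet G → Set
TrivialSMP G F = Even (N G) × HasIsolated F × Even (nV F)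

StronglyMaximallyMatched : Graph → Set
StronglyMaximallyMatched G = SmpIs G (δ G)

EvenStronglySuperMatched : Graph → Set
EvenStronglySuperMatched G =
  StronglyMaximallyMatched G ×
  (∀ F → OptimalSMP G F → Even (nV F) → TrivialSMP G F)

record FracPerfectMatching {G : Graph} (F : DelSet G) : Set where
  field
    f     : Fin (N G) → Fin (N G) → ℚ
    f-sym : ∀ u v → f u v ≡ f v u
    f-lo  : ∀ u v → 0ℚ ≤ℚ f u v
    f-hi  : ∀ u v → f u v ≤ℚ 1ℚ
    f-sup : ∀ u v → edgeH F u v ≡ false → f u v ≡ 0ℚ
    f-sum : ∀ v → alive F v ≡ true → sumℚ (λ u → f u v) ≡ 1ℚ

IsFSMPSet : (G : Graph) → DelSet G → Set
IsFSMPSet G F = ¬ FracPerfectMatching F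

FsmpIs : Graph → ℕ → Set
FsmpIs G k = Σ (DelSet G) (λ F → IsFSMPSet G F × size F ≡ k)
           × (∀ F → IsFSMPSet G F → k ≤ size F)

OptimalFSMP : (G : Graph) → DelSet G → Set
OptimalFSMP G F = IsFSMPSet G F × (∀ F' → IsFSMPSet G F' → size F ≤ size F')

FractionalStronglyMaximallyMatched : Graph → Set
FractionalStronglyMaximallyMatched G = FsmpIs G (δ G)

FractionalStronglySuperMatched : Graph → Set
FractionalStronglySuperMatched G =
  FractionalStronglyMaximallyMatched G × (∀ F → OptimalFSMP G F → HasIsolated F)

crossAdj : ∀ {N₁ N₂} → (Fin N₁ → Fin N₁ → Bool) → (Fin N₂ → Fin N₂ → Bool)
         → (Fin N₁ → Fin N₂ → Bool) → Fin N₁ ⊎ Fin N₂ → Fin N₁ ⊎ Fin N₂ → Bool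
crossAdj a₁ a₂ c (inj₁ x) (inj₁ y) = a₁ x y
crossAdj a₁ a₂ c (inj₂ x) (inj₂ y) = a₂ x y
crossAdj a₁ a₂ c (inj₁ x) (inj₂ y) = c x y
crossAdj a₁ a₂ c (inj₂ x) (inj₁ y) = c y x

crossAdj-sym : ∀ {N₁ N₂} (a₁ : Fin N₁ → Fin N₁ → Bool) (a₂ : Fin N₂ → Fin N₂ → Bool) c
  → (∀ x y → a₁ x y ≡ a₁ y x) → (∀ x y → a₂ x y ≡ a₂ y x)
  → ∀ s t → crossAdj a₁ a₂ c s t ≡ crossAdj a₁ a₂ c t s
crossAdj-sym a₁ a₂ c s₁ s₂ (inj₁ x) (inj₁ y) = s₁ x y
crossAdj-sym a₁ a₂ c s₁ s₂ (inj₂ x) (inj₂ y) = s₂ x y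
crossAdj-sym a₁ a₂ c s₁ s₂ (inj₁ x) (inj₂ y) = refl
crossAdj-sym a₁ a₂ c s₁ s₂ (inj₂ x) (inj₁ y) = refl

crossAdj-irr : ∀ {N₁ N₂} (a₁ : Fin N₁ → Fin N₁ → Bool) (a₂ : Fin N₂ → Fin N₂ → Bool) c
  → (∀ x → a₁ x x ≡ false) → (∀ x → a₂ x x ≡ false)
  → ∀ s → crossAdj a₁ a₂ c s s ≡ false
crossAdj-irr a₁ a₂ c i₁ i₂ (inj₁ x) = i₁ x
crossAdj-irr a₁ a₂ c i₁ i₂ (inj₂ x) = i₂ x

joinG : (G₁ G₂ : Graph) → (Fin (N G₁) → Fin (N G₂) → Bool) → Graph
joinG G₁ G₂ c = record
  { N = N G₁ + N G₂
  ; adj = λ u v → crossAdj (adj G₁) (adj G₂) c (splitAt (N G₁) u) (splitAt (N G₁) v)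
  ; adj-sym = λ u v → crossAdj-sym (adj G₁) (adj G₂) c (adj-sym G₁) (adj-sym G₂)
                        (splitAt (N G₁) u) (splitAt (N G₁) v)
  ; adj-irr = λ u → crossAdj-irr (adj G₁) (adj G₂) c (adj-irr G₁) (adj-irr G₂)
                        (splitAt (N G₁) u)
  }

-- augmented cubes; vertex i of AQ n is the n-bit string of i (most
-- significant bit = prefix bit); opposite = bitwise complement
K₁ : Graph
K₁ = record { N = 1 ; adj = λ _ _ → false ; adj-sym = λ _ _ → refl ; adj-irr = λ _ → refl }

K₂ : Graph
K₂ = record { N = 2 ; adj = λ u v → not ⌊ u ≟F v ⌋ ; adj-sym = sy ; adj-irr = ir }
  where
  sy : ∀ (u v : Fin 2) → not ⌊ u ≟F v ⌋ ≡ not ⌊ v ≟F u ⌋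
  sy zero zero = refl
  sy zero (suc zero) = refl
  sy (suc zero) zero = refl
  sy (suc zero) (suc zero) = refl
  ir : ∀ (u : Fin 2) → not ⌊ u ≟F u ⌋ ≡ false
  ir zero = refl
  ir (suc zero) = refl

AQ : ℕ → Graph
AQ zero = K₁
AQ (suc zero) = K₂
AQ (suc (suc n)) = joinG (AQ (suc n)) (AQ (suc n))
  (λ u v → ⌊ u ≟F v ⌋ ∨ ⌊ v ≟F opposite u ⌋)

IsPerfectBetween : ∀ {N₁ N₂} → (Fin N₁ → Fin N₂ → Bool) → Set
IsPerfectBetween {N₁} {N₂} M =
  (∀ x → count (λ y → M x y) ≡ 1) × (∀ y → count (λ x → M x y) ≡ 1)

EdgeDisjoint : ∀ {N₁ N₂} → (Fin N₁ → Fin N₂ → Bool) → (Fin N₁ → Fin N₂ → Bool) → Set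
EdgeDisjoint M₁ M₂ = ∀ x y → M₁ x y ∧ M₂ x y ≡ false

data GAQ : ℕ → Graph → Set where
  gaq4 : GAQ 4 (AQ 4)
  gaqS : ∀ {n G₁ G₂} → GAQ n G₁ → GAQ n G₂
       → (M₁ M₂ : Fin (N G₁) → Fin (N G₂) → Bool)
       → IsPerfectBetween M₁ → IsPerfectBetween M₂ → EdgeDisjoint M₁ M₂
       → GAQ (suc n) (joinG G₁ G₂ (λ x y → M₁ x y ∨ M₂ x y))

{-# OPTIONS --safe #-}
module Submission where

-- By Hall's theorem on the bipartite double cover, G − F has a fractional perfect matching iff
-- |S| ≤ |N(S)| for every set S of surviving vertices, and S may be taken independent. Let G₁, G₂
-- be the halves of G, of valency d, and let F have at most d + 2 elements. A half with fewer than d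
-- faults satisfies Hall's condition by hypothesis (2); this yields a surplus of d − 1 − |Fᵢ| for
-- independent sets, and a deficit of at most 2e when there are d − 1 + e faults. As d ≥ 7, the
-- surplus of one half pays for the deficit of the other when S meets both. If S lies in one half,
-- one cross matching gives |S| neighbours up to the faults outside that half, and these are paid
-- for by the neighbours of two vertices of S: two vertices have at most d − 3 common neighbours,
-- which holds in AQ₄ by computation and is inherited by joins.

open import Defs
open import Data.Nat using (ℕ; _≤_; _∸_)
open import Algebra.Bundles using (CommutativeMonoid)
import Algebra.Properties.CommutativeMonoid.Sum as Sum
open import Algebra.Properties.CommutativeSemigroup using (interchange)
open import Data.Bool using (Bool; true; false; _∧_; _∨_; not; if_then_else_)
open import Data.Bool.Properties
  using (∧-conicalˡ; ∧-conicalʳ; ∨-zeroʳ; ∧-zeroʳ; ∧-identityʳ; ¬-not; ∨-comm; ∧-comm)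
  renaming (_≟_ to _≟ᵇ_)
open import Data.Fin using (Fin; zero; suc; _<?_; _↑ˡ_; _↑ʳ_; splitAt; join; toℕ; fromℕ<)
open import Data.Fin.Properties
  using (any?; all?; _≟_; splitAt-↑ˡ; splitAt-↑ʳ; join-splitAt; toℕ-↑ˡ; toℕ-↑ʳ; toℕ<n)
import Data.Nat as ℕ
open import Data.Nat using (zero; suc; _+_; _*_; _<_; z≤n; s≤s; s≤s⁻¹; _≤?_)
open import Data.Nat.Induction using (Acc; acc; <-wellFounded)
open import Data.Nat.Properties hiding (_≟_; _≤?_; _<?_)
open import Data.Nat.Tactic.RingSolver using (solve-∀)
open import Data.Product using (∃; _×_; _,_; proj₁; proj₂)
open import Data.Rational using (ℚ; 0ℚ; 1ℚ; ½) renaming (_+_ to _+ℚ_; _≤_ to _≤ℚ_; _<_ to _<ℚ_)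
import Data.Rational.Properties as ℚ
open import Data.Sum using (_⊎_; inj₁; inj₂; [_,_]′)
open import Function using (_∘_; id)
open import Relation.Binary.PropositionalEquality
open import Relation.Nullary using (¬_; Dec; yes; no; does; contradiction; ⌊_⌋)
open import Relation.Nullary.Decidable
  using (dec-true; dec-false; decidable-stable; isYes≗does; from-yes; _→-dec_; ¬?; _×-dec_)

private variable
  k n d : ℕ

-- Booleans and finite sums of natural numbers.

does-true : ∀ {A : Set} (a? : Dec A) → does a? ≡ true → A
does-true (yes a) _ = a

not-true : ∀ {b} → b ≢ true → not b ≡ true
not-true {false} _ = refl
not-true {true} b≢true = contradiction refl b≢true

not-true⁻ : ∀ {b} → not b ≡ true → b ≢ true
not-true⁻ {false} _ ()

∧-true : ∀ {a b} → a ≡ true → b ≡ true → a ∧ b ≡ true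
∧-true refl refl = refl

∨-true⁻ : ∀ a {b} → a ∨ b ≡ true → a ≡ true ⊎ b ≡ true
∨-true⁻ true  _ = inj₁ refl
∨-true⁻ false e = inj₂ e

∨-trueˡ : ∀ {a} b → a ≡ true → a ∨ b ≡ true
∨-trueˡ b refl = refl

∨-trueʳ : ∀ a {b} → b ≡ true → a ∨ b ≡ true
∨-trueʳ a refl = ∨-zeroʳ a

sumℕ≡sum : (f : Fin n → ℕ) → sumℕ f ≡ Sum.sum +-0-commutativeMonoid f
sumℕ≡sum {zero}  f = refl
sumℕ≡sum {suc n} f = cong (f zero +_) (sumℕ≡sum (f ∘ suc))

sumℕ-cong : {f g : Fin n → ℕ} → (∀ i → f i ≡ g i) → sumℕ f ≡ sumℕ g
sumℕ-cong {zero}  h = refl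
sumℕ-cong {suc n} h = cong₂ _+_ (h zero) (sumℕ-cong (h ∘ suc))

sumℕ-+ : (f g : Fin n → ℕ) → sumℕ (λ i → f i + g i) ≡ sumℕ f + sumℕ g
sumℕ-+ {zero}  f g = refl
sumℕ-+ {suc n} f g = trans (cong (f zero + g zero +_) (sumℕ-+ (f ∘ suc) (g ∘ suc)))
  (interchange +-commutativeSemigroup (f zero) (g zero) _ _)

sumℕ-swap : (f : Fin k → Fin n → ℕ) →
  sumℕ (λ i → sumℕ (f i)) ≡ sumℕ (λ j → sumℕ (λ i → f i j))
sumℕ-swap f = begin
  sumℕ (λ i → sumℕ (f i))         ≡⟨ toSum f ⟩
  sum (λ i → sum (f i))           ≡⟨ ∑-comm f ⟩
  sum (λ j → sum (λ i → f i j))   ≡⟨ sym (toSum (λ j i → f i j)) ⟩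
  sumℕ (λ j → sumℕ (λ i → f i j)) ∎
  where
  open ≡-Reasoning
  open Sum +-0-commutativeMonoid using (sum; ∑-comm)
  toSum : ∀ {k n} (f : Fin k → Fin n → ℕ) → sumℕ (λ i → sumℕ (f i)) ≡ sum (λ i → sum (f i))
  toSum f = trans (sumℕ-cong (λ i → sumℕ≡sum (f i))) (sumℕ≡sum (λ i → sum (f i)))

sumℕ-mono : {f g : Fin n → ℕ} → (∀ i → f i ≤ g i) → sumℕ f ≤ sumℕ g
sumℕ-mono {zero}  h = z≤n
sumℕ-mono {suc n} h = +-mono-≤ (h zero) (sumℕ-mono (h ∘ suc))

sumℕ-mono-< : {f g : Fin n → ℕ} → (∀ i → f i ≤ g i) → ∀ i → f i < g i → sumℕ f < sumℕ g
sumℕ-mono-< h zero    lt = +-mono-<-≤ lt (sumℕ-mono (h ∘ suc))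
sumℕ-mono-< h (suc i) lt = +-mono-≤-< (h zero) (sumℕ-mono-< (h ∘ suc) i lt)

-- A single strict inequality would make the sums differ. This is what later turns an injection of
-- the surviving vertices into a bijection.
sumℕ-rigid : {f g : Fin n → ℕ} → (∀ i → f i ≤ g i) → sumℕ f ≡ sumℕ g → ∀ i → f i ≡ g i
sumℕ-rigid h eq i with m≤n⇒m<n∨m≡n (h i)
... | inj₁ lt = contradiction eq (<⇒≢ (sumℕ-mono-< h i lt))
... | inj₂ e  = e

sumℕ-pos : (f : Fin n → ℕ) → 1 ≤ sumℕ f → ∃ λ i → 1 ≤ f i
sumℕ-pos {suc n} f h with f zero in eq
... | suc _ = zero , subst (1 ≤_) (sym eq) (s≤s z≤n)
... | zero with sumℕ-pos (f ∘ suc) h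
...   | i , p = suc i , p

sumℕ-split : ∀ m {n} (f : Fin (m + n) → ℕ) →
  sumℕ f ≡ sumℕ (λ i → f (i ↑ˡ n)) + sumℕ (λ j → f (m ↑ʳ j))
sumℕ-split zero    f = refl
sumℕ-split (suc m) f = trans (cong (f zero +_) (sumℕ-split m (f ∘ suc))) (sym (+-assoc (f zero) _ _))

bit : Bool → ℕ
bit b = if b then 1 else 0

bit-mono : ∀ {a b} → (a ≡ true → b ≡ true) → bit a ≤ bit b
bit-mono {false} h = z≤n
bit-mono {true}  h rewrite h refl = ≤-refl

bit-pos : ∀ {b} → 1 ≤ bit b → b ≡ true
bit-pos {true} _ = refl

-- Decidable subsets of `Fin n` and their cardinalities.

FinSet : ℕ → Set
FinSet n = Fin n → Bool

infix 4 _∈_ _⊆_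
infixr 7 _∩_
infixr 6 _∪_
infixl 8 _∖_

_∈_ : Fin n → FinSet n → Set
x ∈ p = p x ≡ true

_⊆_ : FinSet n → FinSet n → Set
p ⊆ q = ∀ x → x ∈ p → x ∈ q

_∪_ _∩_ : FinSet n → FinSet n → FinSet n
(p ∪ q) x = p x ∨ q x
(p ∩ q) x = p x ∧ q x

⟦_⟧ : Fin n → FinSet n
⟦ x ⟧ y = does (x ≟ y)

_∖_ : FinSet n → Fin n → FinSet n
(p ∖ x) y = p y ∧ not (does (x ≟ y))

∈∖ : ∀ (p : FinSet n) {x y} → y ∈ p → x ≢ y → y ∈ p ∖ x
∈∖ p {x} {y} y∈p x≢y = ∧-true y∈p (cong not (dec-false (x ≟ y) x≢y))

∖⊆ : ∀ (p : FinSet n) x → p ∖ x ⊆ p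
∖⊆ p x y = ∧-conicalˡ (p y) _

∖-≢ : ∀ (p : FinSet n) x {y} → y ∈ p ∖ x → x ≢ y
∖-≢ p x {y} y∈ = not-true⁻ (∧-conicalʳ (p y) _ y∈) ∘ dec-true (x ≟ y)

count≡sum : (p : FinSet n) → count p ≡ sumℕ (bit ∘ p)
count≡sum {zero}  p = refl
count≡sum {suc n} p = cong (bit (p zero) +_) (count≡sum (p ∘ suc))

count-cong : {p q : FinSet n} → (∀ x → p x ≡ q x) → count p ≡ count q
count-cong {zero}  h = refl
count-cong {suc n} h = cong₂ _+_ (cong bit (h zero)) (count-cong (h ∘ suc))

count-mono : {p q : FinSet n} → p ⊆ q → count p ≤ count q
count-mono {zero}  h = z≤n
count-mono {suc n} {p} {q} h = +-mono-≤ (bit-mono (h zero)) (count-mono {p = p ∘ suc} {q ∘ suc} (h ∘ suc))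

count-false : count {n} (λ _ → false) ≡ 0
count-false {zero}  = refl
count-false {suc n} = count-false {n}

count-∪-∩ : (p q : FinSet n) → count (p ∪ q) + count (p ∩ q) ≡ count p + count q
count-∪-∩ {zero}  p q = refl
count-∪-∩ {suc n} p q = begin
  (bit (p∪q zero) + count (p∪q ∘ suc)) + (bit (p∩q zero) + count (p∩q ∘ suc))
    ≡⟨ interchange +-commutativeSemigroup (bit (p∪q zero)) _ _ _ ⟩
  (bit (p∪q zero) + bit (p∩q zero)) + (count (p∪q ∘ suc) + count (p∩q ∘ suc))
    ≡⟨ cong₂ _+_ (bits (p zero) (q zero)) (count-∪-∩ (p ∘ suc) (q ∘ suc)) ⟩
  (bit (p zero) + bit (q zero)) + (count (p ∘ suc) + count (q ∘ suc))
    ≡⟨ interchange +-commutativeSemigroup (bit (p zero)) _ _ _ ⟩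
  count p + count q ∎
  where
  open ≡-Reasoning
  p∪q = p ∪ q
  p∩q = p ∩ q
  bits : ∀ a b → bit (a ∨ b) + bit (a ∧ b) ≡ bit a + bit b
  bits false b = +-identityʳ (bit b)
  bits true  b = refl

count-∪ : (p q : FinSet n) → count (p ∪ q) ≤ count p + count q
count-∪ p q = ≤-trans (m≤m+n _ _) (≤-reflexive (count-∪-∩ p q))

count-split : ∀ m {n} (p : FinSet (m + n)) →
  count p ≡ count (λ i → p (i ↑ˡ n)) + count (λ j → p (m ↑ʳ j))
count-split zero    p = refl
count-split (suc m) p =
  trans (cong (bit (p zero) +_) (count-split m (p ∘ suc))) (sym (+-assoc (bit (p zero)) _ _))

count-⟦⟧ : (x : Fin n) → count ⟦ x ⟧ ≡ 1
count-⟦⟧ {suc n} zero    = cong suc (count-false {n})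
count-⟦⟧ {suc n} (suc x) = count-⟦⟧ x

count-pos : (p : FinSet n) {x : Fin n} → x ∈ p → 1 ≤ count p
count-pos p {x} x∈p = subst (_≤ count p) (count-⟦⟧ x)
  (count-mono (λ y e → subst (_∈ p) (does-true (x ≟ y) e) x∈p))

count-pos⁻ : (p : FinSet n) → 1 ≤ count p → ∃ (_∈ p)
count-pos⁻ p h with sumℕ-pos (bit ∘ p) (subst (1 ≤_) (count≡sum p) h)
... | x , 1≤ = x , bit-pos 1≤

count-∖ : (p : FinSet n) (x : Fin n) → count p ≤ suc (count (p ∖ x))
count-∖ p x = begin
  count p                          ≤⟨ count-mono cover ⟩
  count (⟦ x ⟧ ∪ (p ∖ x))          ≤⟨ count-∪ ⟦ x ⟧ (p ∖ x) ⟩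
  count ⟦ x ⟧ + count (p ∖ x)      ≡⟨ cong (_+ count (p ∖ x)) (count-⟦⟧ x) ⟩
  suc (count (p ∖ x))              ∎
  where
  open ≤-Reasoning
  cover : p ⊆ ⟦ x ⟧ ∪ (p ∖ x)
  cover y y∈p with does (x ≟ y)
  ... | true  = refl
  ... | false = trans (∧-identityʳ (p y)) y∈p

∖-count : (p : FinSet n) {x : Fin n} → x ∈ p → suc (count (p ∖ x)) ≤ count p
∖-count {n} p {x} x∈p = begin
  suc (count (p ∖ x))                               ≡⟨ cong (_+ count (p ∖ x)) (sym (count-⟦⟧ x)) ⟩
  count ⟦ x ⟧ + count (p ∖ x)                       ≡⟨ sym (count-∪-∩ ⟦ x ⟧ (p ∖ x)) ⟩
  count (⟦ x ⟧ ∪ (p ∖ x)) + count (⟦ x ⟧ ∩ (p ∖ x)) ≤⟨ +-mono-≤ (count-mono within) (count-mono disjoint) ⟩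
  count p + count {n} (λ _ → false)                 ≡⟨ cong (count p +_) (count-false {n}) ⟩
  count p + 0                                       ≡⟨ +-identityʳ _ ⟩
  count p                                           ∎
  where
  open ≤-Reasoning
  within : ⟦ x ⟧ ∪ (p ∖ x) ⊆ p
  within y y∈ with ∨-true⁻ (⟦ x ⟧ y) y∈
  ... | inj₁ e = subst (_∈ p) (does-true (x ≟ y) e) x∈p
  ... | inj₂ e = ∖⊆ p x y e
  disjoint : ⟦ x ⟧ ∩ (p ∖ x) ⊆ (λ _ → false)
  disjoint y y∈ = contradiction (does-true (x ≟ y) (∧-conicalˡ (⟦ x ⟧ y) _ y∈))
    (∖-≢ p x (∧-conicalʳ (⟦ x ⟧ y) _ y∈))

two-elements : (p : FinSet n) → 2 ≤ count p → ∃ λ x → ∃ λ y → x ≢ y × x ∈ p × y ∈ p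
two-elements p h with count-pos⁻ p (≤-trans (s≤s z≤n) h)
... | x , x∈p with count-pos⁻ (p ∖ x) (s≤s⁻¹ (≤-trans h (count-∖ p x)))
...   | y , y∈ = x , y , ∖-≢ p x y∈ , x∈p , ∖⊆ p x y y∈

count-pair : (p : FinSet n) {x y : Fin n} → x ≢ y → x ∈ p → y ∈ p → 2 ≤ count p
count-pair p {x} x≢y x∈p y∈p = ≤-trans (s≤s (count-pos (p ∖ x) (∈∖ p y∈p x≢y))) (∖-count p x∈p)

count-subadd : {p q r : FinSet n} → p ⊆ q ∪ r → count p ≤ count q + count r
count-subadd {q = q} {r} h = ≤-trans (count-mono h) (count-∪ q r)

-- Hall's theorem

Rel : ℕ → ℕ → Set
Rel k n = Fin k → Fin n → Bool

nbhd : Rel k n → FinSet k → FinSet n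
nbhd R S y = does (any? (λ x → (S x ∧ R x y) ≟ᵇ true))

nbhd⁺ : ∀ (R : Rel k n) S {x y} → x ∈ S → R x y ≡ true → y ∈ nbhd R S
nbhd⁺ R S {x} {y} x∈S xRy = dec-true (any? (λ x → (S x ∧ R x y) ≟ᵇ true)) (x , ∧-true x∈S xRy)

nbhd⁻ : ∀ (R : Rel k n) S {y} → y ∈ nbhd R S → ∃ λ x → x ∈ S × R x y ≡ true
nbhd⁻ R S {y} h with does-true (any? (λ x → (S x ∧ R x y) ≟ᵇ true)) h
... | x , e = x , ∧-conicalˡ (S x) _ e , ∧-conicalʳ (S x) _ e

nbhd-mono : ∀ (R Q : Rel k n) S → (∀ {x y} → x ∈ S → R x y ≡ true → Q x y ≡ true) → nbhd R S ⊆ nbhd Q S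
nbhd-mono R Q S h y y∈ with nbhd⁻ R S y∈
... | x , x∈S , xRy = nbhd⁺ Q S x∈S (h x∈S xRy)

Hall : FinSet k → Rel k n → Set
Hall L R = ∀ A → A ⊆ L → count A ≤ count (nbhd R A)

-- A matching that covers `L`. Rows outside `L` may have any entries, which is why `columns` filters
-- by `L`; a relation that is functional on `L` can then serve as its own matching.
record Saturating (L : FinSet k) (R : Rel k n) : Set where
  field
    M       : Rel k n
    M⊆R     : ∀ {x y} → M x y ≡ true → R x y ≡ true
    rows    : ∀ {x} → x ∈ L → count (M x) ≡ 1
    columns : ∀ y → count (λ x → L x ∧ M x y) ≤ 1

_-[_,_] : Rel k n → Fin k → Fin n → Rel k n
(R -[ x , y ]) a b = R a b ∧ not (does (x ≟ a) ∧ does (y ≟ b))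

module _ (R : Rel k n) (x : Fin k) (y : Fin n) where

  -[]⁻ : ∀ a b → (R -[ x , y ]) a b ≡ true → R a b ≡ true
  -[]⁻ a b = ∧-conicalˡ (R a b) _

  -[]⁺ : ∀ {a b} → R a b ≡ true → ¬ (x ≡ a × y ≡ b) → (R -[ x , y ]) a b ≡ true
  -[]⁺ {a} {b} aRb ne = ∧-true aRb (not-true λ e →
    ne (does-true (x ≟ a) (∧-conicalˡ (does (x ≟ a)) _ e) , does-true (y ≟ b) (∧-conicalʳ (does (x ≟ a)) _ e)))

  -[]-≢ : (R -[ x , y ]) x y ≢ true
  -[]-≢ e = not-true⁻ (∧-conicalʳ (R x y) _ e) (∧-true (dec-true (x ≟ x) refl) (dec-true (y ≟ y) refl))

  -- The total number of pairs is the measure on which `hall⇒saturating` recurses.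
  -[]-total : R x y ≡ true → sumℕ (λ a → count ((R -[ x , y ]) a)) < sumℕ (λ a → count (R a))
  -[]-total xRy = sumℕ-mono-< (λ a → count-mono (-[]⁻ a)) x
    (≤-trans (s≤s (count-mono {q = R x ∖ y} λ b e → ∈∖ (R x) {y} (-[]⁻ x b e) λ { refl → -[]-≢ e })) (∖-count (R x) xRy))

-- Rado's argument: if neither of two edges at x can be dropped, the two violating sets
-- A and B uncross to a violation of Hall's condition by A ∪ B or by (A ∩ B) ∖ x.
uncross : ∀ {L : FinSet k} {R : Rel k n} {x y z} → Hall L R → y ≢ z →
  ∀ {A B} → A ⊆ L → B ⊆ L →
  count (nbhd (R -[ x , y ]) A) < count A → ¬ (count (nbhd (R -[ x , z ]) B) < count B)
uncross {L = L} {R} {x} {y} {z} hall y≢z {A} {B} A⊆L B⊆L A> B> =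
  <⇒≱ (n<1+n _) (begin
    suc (suc (NA + NB))             ≡⟨ cong suc (sym (+-suc NA NB)) ⟩
    suc NA + suc NB                 ≤⟨ +-mono-≤ A> B> ⟩
    count A + count B               ≡⟨ sym (count-∪-∩ A B) ⟩
    count (A ∪ B) + count (A ∩ B)   ≤⟨ +-mono-≤ union inter ⟩
    count (U ∪ V) + suc (count (U ∩ V)) ≡⟨ +-suc _ _ ⟩
    suc (count (U ∪ V) + count (U ∩ V)) ≡⟨ cong suc (count-∪-∩ U V) ⟩
    suc (NA + NB)                   ∎)
  where
  open ≤-Reasoning
  U = nbhd (R -[ x , y ]) A
  V = nbhd (R -[ x , z ]) B
  NA = count U
  NB = count V
  -- A set without `x` keeps its whole neighbourhood when a pair at `x` is dropped, so it cannot
  -- become violating.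
  contains : ∀ w C → C ⊆ L → count (nbhd (R -[ x , w ]) C) < count C → x ∈ C
  contains w C C⊆L C> with C x in eq
  ... | true  = refl
  ... | false = contradiction (≤-trans C> (≤-trans (hall C C⊆L) (count-mono
                  (nbhd-mono R (R -[ x , w ]) C λ a∈C aRb → -[]⁺ R x w aRb
                    λ { (refl , _) → contradiction (trans (sym eq) a∈C) λ () })))) (n≮n _)
  x∈A = contains y A A⊆L A>
  x∈B = contains z B B⊆L B>
  A∪B⊆L : A ∪ B ⊆ L
  A∪B⊆L a a∈ = [ A⊆L a , B⊆L a ]′ (∨-true⁻ (A a) a∈)
  -- Each deletion spares what the other removes: since `y ≢ z`, the pair `xy` survives in the
  -- second relation and all other pairs at `x` survive in the first.
  union∈ : ∀ {a b} → a ∈ A ∪ B → R a b ≡ true → Dec (x ≡ a) → Dec (y ≡ b) → b ∈ U ∪ V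
  union∈ a∈ aRb (yes refl) (no y≢b)   = ∨-trueˡ _ (nbhd⁺ (R -[ x , y ]) A x∈A (-[]⁺ R x y aRb (y≢b ∘ proj₂)))
  union∈ {b = b} a∈ aRb (yes refl) (yes refl) =
    ∨-trueʳ (U b) (nbhd⁺ (R -[ x , z ]) B x∈B (-[]⁺ R x z aRb (y≢z ∘ sym ∘ proj₂)))
  union∈ {a} {b} a∈ aRb (no x≢a) _ with ∨-true⁻ (A a) a∈
  ... | inj₁ a∈A = ∨-trueˡ _ (nbhd⁺ (R -[ x , y ]) A a∈A (-[]⁺ R x y aRb (x≢a ∘ proj₁)))
  ... | inj₂ a∈B = ∨-trueʳ (U b) (nbhd⁺ (R -[ x , z ]) B a∈B (-[]⁺ R x z aRb (x≢a ∘ proj₁)))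
  union⊆ : nbhd R (A ∪ B) ⊆ U ∪ V
  union⊆ b b∈ = let a , a∈ , aRb = nbhd⁻ R (A ∪ B) b∈ in union∈ a∈ aRb (x ≟ a) (y ≟ b)
  union : count (A ∪ B) ≤ count (U ∪ V)
  union = ≤-trans (hall (A ∪ B) A∪B⊆L) (count-mono union⊆)
  -- Away from `x` neither deletion matters, so the neighbours of `C` lie in both `U` and `V`.
  -- Leaving out `x` costs one, while the two violations together give two.
  C = (A ∩ B) ∖ x
  inter⊆ : nbhd R C ⊆ U ∩ V
  inter⊆ b b∈ with nbhd⁻ R C b∈
  ... | a , a∈ , aRb = ∧-true
    (nbhd⁺ (R -[ x , y ]) A (∧-conicalˡ (A a) _ (∖⊆ (A ∩ B) x a a∈)) (-[]⁺ R x y aRb (∖-≢ (A ∩ B) x a∈ ∘ proj₁)))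
    (nbhd⁺ (R -[ x , z ]) B (∧-conicalʳ (A a) _ (∖⊆ (A ∩ B) x a a∈)) (-[]⁺ R x z aRb (∖-≢ (A ∩ B) x a∈ ∘ proj₁)))
  inter : count (A ∩ B) ≤ suc (count (U ∩ V))
  inter = ≤-trans (count-∖ (A ∩ B) x) (s≤s (≤-trans
    (hall C (λ a a∈ → A⊆L a (∧-conicalˡ (A a) _ (∖⊆ (A ∩ B) x a a∈)))) (count-mono inter⊆)))

-- Hall's condition on singletons makes each row of `L` nonempty, and on pairs it forbids two rows
-- from sharing their only partner. So `R` itself is the matching.
hall-functional : {L : FinSet k} {R : Rel k n} → Hall L R →
  (∀ {x} → x ∈ L → count (R x) ≤ 1) → Saturating L R
hall-functional {L = L} {R} hall functional = record
  { M       = R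
  ; M⊆R     = id
  ; rows    = λ x∈L → ≤-antisym (functional x∈L) (nonempty x∈L)
  ; columns = λ y → decidable-stable (_ ≤? 1) (λ ≰1 → collision y (two-elements _ (≰⇒> ≰1)))
  }
  where
  nonempty : ∀ {x} → x ∈ L → 1 ≤ count (R x)
  nonempty {x} x∈L = begin
    1                     ≡⟨ sym (count-⟦⟧ x) ⟩
    count ⟦ x ⟧           ≤⟨ hall ⟦ x ⟧ (λ a e → subst (_∈ L) (does-true (x ≟ a) e) x∈L) ⟩
    count (nbhd R ⟦ x ⟧)  ≤⟨ count-mono only ⟩
    count (R x)           ∎
    where
    open ≤-Reasoning
    only : nbhd R ⟦ x ⟧ ⊆ R x
    only b b∈ with nbhd⁻ R ⟦ x ⟧ b∈
    ... | a , a∈ , aRb = subst (λ c → R c b ≡ true) (sym (does-true (x ≟ a) a∈)) aRb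
  collision : ∀ y → ¬ ∃ λ u → ∃ λ v → u ≢ v × (L u ∧ R u y ≡ true) × (L v ∧ R v y ≡ true)
  collision y (u , v , u≢v , u∈ , v∈) = <⇒≱ (n<1+n 1) (begin
    2                          ≤⟨ count-pair P u≢v (∨-trueˡ _ (dec-true (u ≟ u) refl)) (∨-trueʳ (⟦ u ⟧ v) (dec-true (v ≟ v) refl)) ⟩
    count P                    ≤⟨ hall P P⊆L ⟩
    count (nbhd R P)           ≤⟨ count-mono only ⟩
    count (R u)                ≤⟨ functional (∧-conicalˡ (L u) _ u∈) ⟩
    1                          ∎)
    where
    open ≤-Reasoning
    P = ⟦ u ⟧ ∪ ⟦ v ⟧
    P⊆L : P ⊆ L
    P⊆L a a∈ with ∨-true⁻ (⟦ u ⟧ a) a∈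
    ... | inj₁ e = subst (_∈ L) (does-true (u ≟ a) e) (∧-conicalˡ (L u) _ u∈)
    ... | inj₂ e = subst (_∈ L) (does-true (v ≟ a) e) (∧-conicalˡ (L v) _ v∈)
    only-y : ∀ {c} → c ∈ L → R c y ≡ true → ∀ {b} → R c b ≡ true → b ≡ y
    only-y {c} c∈L cRy {b} cRb with b ≟ y
    ... | yes e = e
    ... | no ne = contradiction (≤-trans (count-pair (R c) ne cRb cRy) (functional c∈L)) λ { (s≤s ()) }
    only : nbhd R P ⊆ R u
    only b b∈ with nbhd⁻ R P b∈
    ... | a , a∈ , aRb with ∨-true⁻ (⟦ u ⟧ a) a∈
    ...   | inj₁ e = subst (λ c → R c b ≡ true) (sym (does-true (u ≟ a) e)) aRb
    ...   | inj₂ e with does-true (v ≟ a) e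
    ...     | refl = subst (λ c → R u c ≡ true)
                (sym (only-y (∧-conicalˡ (L v) _ v∈) (∧-conicalʳ (L v) _ v∈) aRb))
                (∧-conicalʳ (L u) _ u∈)

-- While some row of `L` has two partners, `uncross` shows that dropping one of the two pairs
-- preserves Hall's condition. Which of them is not decided, hence the double negation; it is
-- harmless, because being an FSMP set is itself a negated statement.
hall⇒saturating : {L : FinSet k} {R : Rel k n} → Hall L R → ¬ ¬ Saturating L R
hall⇒saturating {L = L} {R} = go R (<-wellFounded _)
  where
  go : ∀ R → Acc _<_ (sumℕ (λ a → count (R a))) → Hall L R → ¬ ¬ Saturating L R
  go R (acc smaller) hall none
    with any? (λ x → (L x ≟ᵇ true) ×-dec (2 ≤? count (R x)))
  ... | no ¬branch = none (hall-functional hall λ x∈L →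
          decidable-stable (_ ≤? 1) λ ≰1 → ¬branch (_ , x∈L , ≰⇒> ≰1))
  ... | yes (x , x∈L , 2≤) with two-elements (R x) 2≤
  ...   | y , z , y≢z , xRy , xRz =
    cannot-drop y xRy λ A A⊆L → decidable-stable (_ ≤? _) λ A≰ →
    cannot-drop z xRz λ B B⊆L → decidable-stable (_ ≤? _) λ B≰ →
    uncross {x = x} hall y≢z A⊆L B⊆L (≰⇒> A≰) (≰⇒> B≰)
    where
    cannot-drop : ∀ w → R x w ≡ true → ¬ Hall L (R -[ x , w ])
    cannot-drop w xRw hall′ = go (R -[ x , w ]) (smaller (-[]-total R x w xRw)) hall′ λ s →
      none (record { M = Saturating.M s ; M⊆R = λ {a} {b} e → -[]⁻ R x w a b (Saturating.M⊆R s e)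
                   ; rows = Saturating.rows s ; columns = Saturating.columns s })

count-swap : (R : Rel k n) → sumℕ (λ x → count (R x)) ≡ sumℕ (λ y → count (λ x → R x y))
count-swap R = begin
  sumℕ (λ x → count (R x))               ≡⟨ sumℕ-cong (λ x → count≡sum (R x)) ⟩
  sumℕ (λ x → sumℕ (λ y → bit (R x y)))  ≡⟨ sumℕ-swap (λ x y → bit (R x y)) ⟩
  sumℕ (λ y → sumℕ (λ x → bit (R x y)))  ≡⟨ sumℕ-cong (λ y → sym (count≡sum (λ x → R x y))) ⟩
  sumℕ (λ y → count (λ x → R x y))       ∎
  where open ≡-Reasoning

-- Fractional perfect matchings

sumℚ-+ : (f g : Fin n → ℚ) → sumℚ (λ i → f i +ℚ g i) ≡ sumℚ f +ℚ sumℚ g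
sumℚ-+ {zero}  f g = refl
sumℚ-+ {suc n} f g = trans (cong (f zero +ℚ g zero +ℚ_) (sumℚ-+ (f ∘ suc) (g ∘ suc)))
  (interchange ℚ+ (f zero) (g zero) (sumℚ (f ∘ suc)) (sumℚ (g ∘ suc)))
  where
  ℚ+ = CommutativeMonoid.commutativeSemigroup ℚ.+-0-commutativeMonoid

sumℚ-0 : (f : Fin n → ℚ) → (∀ i → f i ≡ 0ℚ) → sumℚ f ≡ 0ℚ
sumℚ-0 {zero}  f h = refl
sumℚ-0 {suc n} f h rewrite h zero | sumℚ-0 (f ∘ suc) (h ∘ suc) = refl

sumℚ-swap : (f : Fin k → Fin n → ℚ) →
  sumℚ (λ i → sumℚ (f i)) ≡ sumℚ (λ j → sumℚ (λ i → f i j))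
sumℚ-swap {zero} {n} f = sym (sumℚ-0 {n} (λ _ → 0ℚ) (λ _ → refl))
sumℚ-swap {suc k} f = trans (cong (sumℚ (f zero) +ℚ_) (sumℚ-swap (f ∘ suc)))
  (sym (sumℚ-+ (f zero) (λ j → sumℚ (λ i → f (suc i) j))))

sumℚ-mono : {f g : Fin n → ℚ} → (∀ i → f i ≤ℚ g i) → sumℚ f ≤ℚ sumℚ g
sumℚ-mono {zero}  h = ℚ.≤-refl
sumℚ-mono {suc n} h = ℚ.+-mono-≤ (h zero) (sumℚ-mono (h ∘ suc))

half : Bool → ℚ
half b = if b then ½ else 0ℚ

sumℚ-half : (p : FinSet n) → count p ≡ 1 → sumℚ (half ∘ p) ≡ ½
sumℚ-half {suc n} p eq with p zero
... | false = trans (ℚ.+-identityˡ _) (sumℚ-half (p ∘ suc) eq)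
... | true  = cong (½ +ℚ_) (sumℚ-0 (half ∘ p ∘ suc) λ i → cong half (¬-not λ i∈p →
                contradiction (cong ℕ.pred eq) (>⇒≢ (count-pos (p ∘ suc) i∈p))))

half-bounds? : ∀ a b → Dec (0ℚ ≤ℚ half a +ℚ half b × half a +ℚ half b ≤ℚ 1ℚ)
half-bounds? a b = (0ℚ ℚ.≤? half a +ℚ half b) ×-dec (half a +ℚ half b ℚ.≤? 1ℚ)

half-bounds : ∀ a b → 0ℚ ≤ℚ half a +ℚ half b × half a +ℚ half b ≤ℚ 1ℚ
half-bounds false false = from-yes (half-bounds? false false)
half-bounds false true  = from-yes (half-bounds? false true)
half-bounds true  false = from-yes (half-bounds? true false)
half-bounds true  true  = from-yes (half-bounds? true true)

fromℕ : ℕ → ℚ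
fromℕ zero    = 0ℚ
fromℕ (suc n) = 1ℚ +ℚ fromℕ n

fromℕ-< : k < n → fromℕ k <ℚ fromℕ n
fromℕ-< {zero}  {suc zero}    _ = from-yes (0ℚ ℚ.<? 1ℚ)
fromℕ-< {zero}  {suc (suc n)} _ = ℚ.+-mono-< (from-yes (0ℚ ℚ.<? 1ℚ)) (fromℕ-< {zero} {suc n} (s≤s z≤n))
fromℕ-< {suc k} {suc n} lt = ℚ.+-monoʳ-< 1ℚ (fromℕ-< (s≤s⁻¹ lt))

fromℕ-≤⁻ : fromℕ k ≤ℚ fromℕ n → k ≤ n
fromℕ-≤⁻ k≤n = ≮⇒≥ λ n<k → ℚ.<-irrefl refl (ℚ.<-≤-trans (fromℕ-< n<k) k≤n)

sumℚ-indicator : (p : FinSet n) → sumℚ (λ x → if p x then 1ℚ else 0ℚ) ≡ fromℕ (count p)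
sumℚ-indicator {zero}  p = refl
sumℚ-indicator {suc n} p with p zero
... | true  = cong (1ℚ +ℚ_) (sumℚ-indicator (p ∘ suc))
... | false = trans (ℚ.+-identityˡ _) (sumℚ-indicator (p ∘ suc))

module _ {G : Graph} (F : DelSet G) where

  edgeH-aliveˡ : ∀ {u v} → edgeH F u v ≡ true → u ∈ alive F
  edgeH-aliveˡ {u} = ∧-conicalˡ (alive F u) _

  edgeH-aliveʳ : ∀ {u v} → edgeH F u v ≡ true → v ∈ alive F
  edgeH-aliveʳ {u} {v} = ∧-conicalˡ (alive F v) _ ∘ ∧-conicalʳ (alive F u) _

  edgeH-adj : ∀ {u v} → edgeH F u v ≡ true → adj G u v ≡ true
  edgeH-adj {u} {v} =
    ∧-conicalˡ (adj G u v) _ ∘ ∧-conicalʳ (alive F v) _ ∘ ∧-conicalʳ (alive F u) _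

  edgeH-kept : ∀ {u v} → edgeH F u v ≡ true → not (edel F u v ∨ edel F v u) ≡ true
  edgeH-kept {u} {v} =
    ∧-conicalʳ (adj G u v) _ ∘ ∧-conicalʳ (alive F v) _ ∘ ∧-conicalʳ (alive F u) _

  edgeH⁺ : ∀ {u v} → u ∈ alive F → v ∈ alive F → adj G u v ≡ true →
    not (edel F u v ∨ edel F v u) ≡ true → edgeH F u v ≡ true
  edgeH⁺ u∈ v∈ a e = ∧-true u∈ (∧-true v∈ (∧-true a e))

  edgeH-sym : ∀ {u v} → edgeH F u v ≡ true → edgeH F v u ≡ true
  edgeH-sym {u} {v} e = edgeH⁺ (edgeH-aliveʳ {u} e) (edgeH-aliveˡ e)
    (trans (adj-sym G v u) (edgeH-adj e)) (trans (cong not (∨-comm (edel F v u) _)) (edgeH-kept {u} e))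

  -- Weight counting: every vertex of `S` carries weight one, all of it on edges into `T`, and every
  -- vertex of `T` is alive, as the end of a surviving edge, so it receives at most one.
  fpm⇒hall : FracPerfectMatching F → Hall (alive F) (edgeH F)
  fpm⇒hall fpm S S⊆alive = fromℕ-≤⁻ (begin
    fromℕ (count S)                                          ≡⟨ sym (sumℚ-indicator S) ⟩
    sumℚ (λ v → if S v then 1ℚ else 0ℚ)                      ≤⟨ sumℚ-mono row ⟩
    sumℚ (λ v → sumℚ (λ u → if T u then f u v else 0ℚ))      ≡⟨ sumℚ-swap (λ v u → if T u then f u v else 0ℚ) ⟩
    sumℚ (λ u → sumℚ (λ v → if T u then f u v else 0ℚ))      ≤⟨ sumℚ-mono column ⟩
    sumℚ (λ u → if T u then 1ℚ else 0ℚ)                      ≡⟨ sumℚ-indicator T ⟩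
    fromℕ (count T)                                          ∎)
    where
    open ℚ.≤-Reasoning
    open FracPerfectMatching fpm
    T = nbhd (edgeH F) S
    entry : ∀ {v} u → v ∈ S → f u v ≤ℚ (if T u then f u v else 0ℚ)
    entry {v} u v∈S with T u in eq
    ... | true  = ℚ.≤-refl
    ... | false = ℚ.≤-reflexive (f-sup u v (¬-not λ e →
                    contradiction (trans (sym eq) (nbhd⁺ (edgeH F) S v∈S (edgeH-sym e))) λ ()))
    nonneg : ∀ b {q} → 0ℚ ≤ℚ q → 0ℚ ≤ℚ (if b then q else 0ℚ)
    nonneg true  h = h
    nonneg false h = ℚ.≤-refl
    row : ∀ v → (if S v then 1ℚ else 0ℚ) ≤ℚ sumℚ (λ u → if T u then f u v else 0ℚ)
    row v with S v in eq
    ... | true  = ℚ.≤-trans (ℚ.≤-reflexive (sym (f-sum v (S⊆alive v eq)))) (sumℚ-mono λ u → entry u eq)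
    ... | false = ℚ.≤-trans (ℚ.≤-reflexive (sym (sumℚ-0 {N G} (λ _ → 0ℚ) (λ _ → refl))))
                    (sumℚ-mono λ u → nonneg (T u) (f-lo u v))
    column : ∀ u → sumℚ (λ v → if T u then f u v else 0ℚ) ≤ℚ (if T u then 1ℚ else 0ℚ)
    column u with T u in eq
    ... | false = ℚ.≤-reflexive (sumℚ-0 {N G} (λ _ → 0ℚ) (λ _ → refl))
    ... | true  with nbhd⁻ (edgeH F) S eq
    ...   | v , _ , e = ℚ.≤-trans (sumℚ-mono λ w → ℚ.≤-reflexive (f-sym u w))
                    (ℚ.≤-reflexive (f-sum u (edgeH-aliveʳ {v} e)))

  -- σ is a permutation of the surviving vertices along edges; half its indicator plus half
  -- its transpose is a fractional perfect matching.
  saturating⇒fpm : Saturating (alive F) (edgeH F) → FracPerfectMatching F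
  saturating⇒fpm σ = record
    { f     = λ u v → half (P u v) +ℚ half (P v u)
    ; f-sym = λ u v → ℚ.+-comm (half (P u v)) (half (P v u))
    ; f-lo  = λ u v → proj₁ (half-bounds (P u v) (P v u))
    ; f-hi  = λ u v → proj₂ (half-bounds (P u v) (P v u))
    ; f-sup = λ u v e → cong₂ (λ a b → half a +ℚ half b)
        (¬-not λ p → contradiction (trans (sym e) (P⊆edgeH p)) λ ())
        (¬-not λ p → contradiction (trans (sym e) (edgeH-sym (P⊆edgeH p))) λ ())
    ; f-sum = λ v v∈ → trans (sumℚ-+ (λ u → half (P u v)) (λ u → half (P v u)))
        (cong₂ _+ℚ_ (sumℚ-half (λ u → P u v) (trans (column≡ v) (cong bit v∈)))
                    (sumℚ-half (P v) (trans (row≡ v) (cong bit v∈))))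
    }
    where
    open Saturating σ
    P : Rel (N G) (N G)
    P u v = alive F u ∧ M u v
    P⊆edgeH : ∀ {u v} → P u v ≡ true → edgeH F u v ≡ true
    P⊆edgeH {u} p = M⊆R (∧-conicalʳ (alive F u) _ p)
    row≡ : ∀ u → count (P u) ≡ bit (alive F u)
    row≡ u with alive F u in eq
    ... | true  = rows eq
    ... | false = count-false {N G}
    column≤ : ∀ v → count (λ u → P u v) ≤ bit (alive F v)
    column≤ v with alive F v in eq
    ... | true  = columns v
    ... | false = ≤-trans (count-mono {q = λ _ → false} λ u p →
                    trans (sym eq) (edgeH-aliveʳ {u} (P⊆edgeH p))) (≤-reflexive (count-false {N G}))
    -- Rows and columns have the same total, and the row sums already add up to the number of
    -- survivors. No column bound can be slack, so the injection is a permutation.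
    column≡ : ∀ v → count (λ u → P u v) ≡ bit (alive F v)
    column≡ = sumℕ-rigid column≤ (trans (sym (count-swap P)) (sumℕ-cong row≡))

  hall⇒fpm : Hall (alive F) (edgeH F) → ¬ ¬ FracPerfectMatching F
  hall⇒fpm hall none = hall⇒saturating hall (none ∘ saturating⇒fpm)

bit≤count : (p : FinSet n) (x : Fin n) → bit (p x) ≤ count p
bit≤count p x with p x in eq
... | true  = count-pos p eq
... | false = z≤n

bits≤count : (p : FinSet n) {x y : Fin n} → x ≢ y → bit (p x) + bit (p y) ≤ count p
bits≤count p {x} {y} x≢y with p x in px | p y in py
... | true  | true  = count-pair p x≢y px py
... | true  | false = count-pos p px
... | false | true  = count-pos p py
... | false | false = z≤n

-- Deleted vertices and edges

-- The strict upper triangle holds each unordered pair once; for `edgeInF F` this is the edge part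
-- of `size F`.
upper : Rel n n → ℕ
upper E = sumℕ (λ u → count (λ v → ⌊ u <? v ⌋ ∧ E u v))

upper-suc : (E : Rel (suc n) (suc n)) →
  upper E ≡ count (E zero ∘ suc) + upper (λ u v → E (suc u) (suc v))
upper-suc E = cong (count (E zero ∘ suc) +_) (sumℕ-cong λ u → count-cong λ v →
  cong (_∧ E (suc u) (suc v)) (trans (isYes≗does (suc u <? suc v)) (sym (isYes≗does (u <? v)))))

-- The pairs at one vertex are distinct as unordered pairs. The induction peels off vertex `zero`,
-- whose row accounts for the pair joining it to `v`.
star≤upper : (E : Rel n n) → (∀ u v → E u v ≡ E v u) → (∀ u → E u u ≡ false) →
  ∀ v → count (E v) ≤ upper E
star≤upper E E-sym E-irr zero rewrite upper-suc E | E-irr zero = m≤m+n _ _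
star≤upper E E-sym E-irr (suc v) rewrite upper-suc E | E-sym (suc v) zero =
  +-mono-≤ (bit≤count (E zero ∘ suc) v)
    (star≤upper (λ u v → E (suc u) (suc v)) (λ u v → E-sym (suc u) (suc v)) (λ u → E-irr (suc u)) v)

-- Two stars share at most one unordered pair, the one joining `u` and `v`; being counted twice, it
-- is the source of the `suc`.
two-stars≤upper : (E : Rel n n) → (∀ u v → E u v ≡ E v u) → (∀ u → E u u ≡ false) →
  ∀ u v → u ≢ v → count (E u) + count (E v) ≤ suc (upper E)
two-stars≤upper E E-sym E-irr zero zero u≢v = contradiction refl u≢v
two-stars≤upper E E-sym E-irr zero (suc v) _ rewrite upper-suc E | E-irr zero = begin
  X + (b + count (E (suc v) ∘ suc))  ≤⟨ +-monoʳ-≤ X (+-mono-≤ (bit≤1 (E (suc v) zero))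
      (star≤upper E′ (λ u v → E-sym (suc u) (suc v)) (λ u → E-irr (suc u)) v)) ⟩
  X + suc (upper E′)                 ≡⟨ +-suc X _ ⟩
  suc (X + upper E′)                 ∎
  where
  open ≤-Reasoning
  X = count (E zero ∘ suc)
  b = bit (E (suc v) zero)
  E′ = λ u v → E (suc u) (suc v)
  bit≤1 : ∀ b → bit b ≤ 1
  bit≤1 true  = ≤-refl
  bit≤1 false = z≤n
two-stars≤upper E E-sym E-irr (suc u) zero u≢v =
  subst (_≤ suc (upper E)) (+-comm (count (E zero)) _)
    (two-stars≤upper E E-sym E-irr zero (suc u) (u≢v ∘ sym))
two-stars≤upper E E-sym E-irr (suc u) (suc v) u≢v
  rewrite upper-suc E | E-sym (suc u) zero | E-sym (suc v) zero = begin
  (bu + cu) + (bv + cv)  ≡⟨ interchange +-commutativeSemigroup bu cu bv cv ⟩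
  (bu + bv) + (cu + cv)  ≤⟨ +-mono-≤ (bits≤count (E zero ∘ suc) (u≢v ∘ cong suc))
      (two-stars≤upper E′ (λ u v → E-sym (suc u) (suc v)) (λ u → E-irr (suc u)) u v (u≢v ∘ cong suc)) ⟩
  X + suc (upper E′)     ≡⟨ +-suc X _ ⟩
  suc (X + upper E′)     ∎
  where
  open ≤-Reasoning
  X = count (E zero ∘ suc)
  E′ = λ u v → E (suc u) (suc v)
  bu = bit (E zero (suc u))
  bv = bit (E zero (suc v))
  cu = count (E (suc u) ∘ suc)
  cv = count (E (suc v) ∘ suc)

-- Resilience, valencies, and the effect of single faults on neighbourhoods.

-- The form in which hypothesis (2) is applied to a half, with `d` its valency.
Resilient : ℕ → Graph → Set
Resilient d G = (F : DelSet G) → size F < d → Hall (alive F) (edgeH F)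

codegree : (G : Graph) → Fin (N G) → Fin (N G) → ℕ
codegree G u v = count (λ w → adj G u w ∧ adj G v w)

degree-row : (G : Graph) (v : Fin (N G)) → degree G v ≡ count (adj G v)
degree-row G v = count-cong λ u → adj-sym G u v

-- The structural facts that pass from two halves to their join. In `sparse` the bound of `d` minus
-- three on common neighbours is stated additively, to avoid truncated subtraction.
record Cubelike (d : ℕ) (G : Graph) : Set where
  field
    nonempty : 1 ≤ N G
    regular  : ∀ v → degree G v ≡ d
    sparse   : ∀ u v → u ≢ v → 3 + codegree G u v ≤ d

module _ {G : Graph} where

  delete-vertex restore-vertex : DelSet G → Fin (N G) → DelSet G
  delete-vertex  F x = record { vdel = vdel F ∪ ⟦ x ⟧ ; edel = edel F }
  restore-vertex F x = record { vdel = vdel F ∖ x ; edel = edel F }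

  -- An edge counts as deleted as soon as one orientation is marked in `edel`, so both have to be
  -- cleared.
  restore-edge : DelSet G → Fin (N G) → Fin (N G) → DelSet G
  restore-edge F a b = record { vdel = vdel F ; edel = (edel F -[ a , b ]) -[ b , a ] }

  Independent : DelSet G → FinSet (N G) → Set
  Independent F S = ∀ u v → u ∈ S → v ∈ S → edgeH F u v ≢ true

module _ {G : Graph} (F : DelSet G) where

  edgeInF-sym : ∀ u v → edgeInF F u v ≡ edgeInF F v u
  edgeInF-sym u v = cong₂ _∧_ (adj-sym G u v) (∨-comm (edel F u v) (edel F v u))

  edgeInF-irr : ∀ u → edgeInF F u u ≡ false
  edgeInF-irr u rewrite adj-irr G u = refl

  adj-cases : ∀ {u v} → u ∈ alive F → adj G u v ≡ true →
    edgeH F u v ≡ true ⊎ (v ∈ vdel F ⊎ edgeInF F u v ≡ true)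
  adj-cases {u} {v} u∈ a with vdel F v in dead | edel F u v ∨ edel F v u in del
  ... | true  | _     = inj₂ (inj₁ refl)
  ... | false | true  = inj₂ (inj₂ (∧-true a refl))
  ... | false | false = inj₁ (∧-true u∈ (∧-true a refl))

  size-delete-vertex : ∀ x → size (delete-vertex F x) ≤ suc (size F)
  size-delete-vertex x = +-monoˡ-≤ _ (begin
    count (vdel F ∪ ⟦ x ⟧)          ≤⟨ count-∪ (vdel F) ⟦ x ⟧ ⟩
    count (vdel F) + count ⟦ x ⟧    ≡⟨ cong (count (vdel F) +_) (count-⟦⟧ x) ⟩
    count (vdel F) + 1              ≡⟨ +-comm _ 1 ⟩
    suc (count (vdel F))            ∎)
    where open ≤-Reasoning

  size-restore-vertex : ∀ x → x ∈ vdel F → size (restore-vertex F x) < size F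
  size-restore-vertex x x∈ = +-monoˡ-≤ _ (∖-count (vdel F) x∈)

  edel-restored⁻ : ∀ a b u v → edel (restore-edge F a b) u v ≡ true → edel F u v ≡ true
  edel-restored⁻ a b u v e = -[]⁻ (edel F) a b u v (-[]⁻ (edel F -[ a , b ]) b a u v e)

  size-restore-edge : ∀ a b → ⌊ a <? b ⌋ ∧ edgeInF F a b ≡ true → size (restore-edge F a b) < size F
  size-restore-edge a b e = +-monoʳ-< (nV F) (sumℕ-mono-< (λ u → count-mono (kept u)) a
    (≤-trans (s≤s (count-mono {q = row ∖ b} λ v e′ → ∈∖ row {b} (kept a v e′) λ { refl → gone e′ }))
      (∖-count row {b} e)))
    where
    F′ = restore-edge F a b
    row : FinSet (N G)
    row v = ⌊ a <? v ⌋ ∧ edgeInF F a v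
    kept : ∀ u v → ⌊ u <? v ⌋ ∧ edgeInF F′ u v ≡ true → ⌊ u <? v ⌋ ∧ edgeInF F u v ≡ true
    kept u v e = ∧-true (∧-conicalˡ ⌊ u <? v ⌋ _ e) (∧-true (∧-conicalˡ (adj G u v) _ e′) deleted)
      where
      e′ = ∧-conicalʳ ⌊ u <? v ⌋ _ e
      deleted : edel F u v ∨ edel F v u ≡ true
      deleted with ∨-true⁻ (edel F′ u v) (∧-conicalʳ (adj G u v) _ e′)
      ... | inj₁ uv = ∨-trueˡ _ (edel-restored⁻ a b u v uv)
      ... | inj₂ vu = ∨-trueʳ (edel F u v) (edel-restored⁻ a b v u vu)
    gone : ⌊ a <? b ⌋ ∧ edgeInF F′ a b ≢ true
    gone e with ∨-true⁻ (edel F′ a b) (∧-conicalʳ (adj G a b) _ (∧-conicalʳ ⌊ a <? b ⌋ _ e))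
    ... | inj₁ ab = -[]-≢ (edel F) a b (-[]⁻ (edel F -[ a , b ]) b a a b ab)
    ... | inj₂ ba = -[]-≢ (edel F -[ a , b ]) b a ba

  some-fault : 1 ≤ size F →
    (∃ (_∈ vdel F)) ⊎ (∃ λ a → ∃ λ b → ⌊ a <? b ⌋ ∧ edgeInF F a b ≡ true)
  some-fault 1≤ with nV F in eq
  ... | suc _ = inj₁ (count-pos⁻ (vdel F) (subst (1 ≤_) (sym eq) (s≤s z≤n)))
  ... | zero with sumℕ-pos _ 1≤
  ...   | a , 1≤row = inj₂ (a , count-pos⁻ _ 1≤row)

  nbhd-restore-vertex : ∀ x S → S ⊆ alive F →
    nbhd (edgeH (restore-vertex F x)) S ⊆ nbhd (edgeH F) S ∪ ⟦ x ⟧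
  nbhd-restore-vertex x S S⊆ u u∈ with nbhd⁻ (edgeH (restore-vertex F x)) S u∈
  ... | v , v∈S , e = case (x ≟ u)
    where
    F′ = restore-vertex F x
    case : Dec (x ≡ u) → u ∈ nbhd (edgeH F) S ∪ ⟦ x ⟧
    case (yes x≡u) = ∨-trueʳ (nbhd (edgeH F) S u) (dec-true (x ≟ u) x≡u)
    case (no x≢u)  = ∨-trueˡ _ (nbhd⁺ (edgeH F) S v∈S (edgeH⁺ F (S⊆ v v∈S)
      (not-true λ dead → not-true⁻ (edgeH-aliveʳ F′ {v} {u} e) (∈∖ (vdel F) dead x≢u))
      (edgeH-adj F′ {v} {u} e) (edgeH-kept F′ {v} {u} e)))

  -- With `a` taken out of `S`, the restored edge can only be used from `b` towards `a`, so `a` is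
  -- the only possible new neighbour.
  nbhd-restore-edge : ∀ a b S →
    nbhd (edgeH (restore-edge F a b)) (S ∖ a) ⊆ nbhd (edgeH F) S ∪ ⟦ a ⟧
  nbhd-restore-edge a b S u u∈ with nbhd⁻ (edgeH (restore-edge F a b)) (S ∖ a) u∈
  ... | v , v∈ , e = case (a ≟ u)
    where
    F′ = restore-edge F a b
    case : Dec (a ≡ u) → u ∈ nbhd (edgeH F) S ∪ ⟦ a ⟧
    case (yes a≡u) = ∨-trueʳ (nbhd (edgeH F) S u) (dec-true (a ≟ u) a≡u)
    case (no a≢u)  = ∨-trueˡ _ (nbhd⁺ (edgeH F) S (∖⊆ S a v v∈)
      (edgeH⁺ F (edgeH-aliveˡ F′ {v} {u} e) (edgeH-aliveʳ F′ {v} {u} e) (edgeH-adj F′ {v} {u} e)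
        (not-true λ del → not-true⁻ (edgeH-kept F′ {v} {u} e) (still-deleted del))))
      where
      keep : ∀ w z → a ≢ w → a ≢ z → edel F w z ≡ true → edel F′ w z ≡ true
      keep w z a≢w a≢z wz = -[]⁺ (edel F -[ a , b ]) b a
        (-[]⁺ (edel F) a b wz (a≢w ∘ proj₁)) (a≢z ∘ proj₂)
      still-deleted : edel F v u ∨ edel F u v ≡ true → edel F′ v u ∨ edel F′ u v ≡ true
      still-deleted del with ∨-true⁻ (edel F v u) del
      ... | inj₁ vu = ∨-trueˡ _ (keep v u (∖-≢ S a v∈) a≢u vu)
      ... | inj₂ uv = ∨-trueʳ (edel F′ v u) (keep u v a≢u (∖-≢ S a v∈) uv)

  -- Every neighbour of an isolated `v` accounts for a fault of its own: either it is dead or its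
  -- edge to `v` is deleted.
  degree-faults : ∀ {v} → v ∈ alive F → (∀ u → edgeH F u v ≡ false) → degree G v ≤ size F
  degree-faults {v} v∈ isolated = begin
    degree G v                                     ≡⟨ degree-row G v ⟩
    count (adj G v)                                ≤⟨ count-subadd {p = adj G v} {vdel F} {edgeInF F v} lost ⟩
    nV F + count (edgeInF F v)                     ≤⟨ +-monoʳ-≤ (nV F)
      (star≤upper (edgeInF F) edgeInF-sym edgeInF-irr v) ⟩
    size F                                         ∎
    where
    open ≤-Reasoning
    lost : adj G v ⊆ vdel F ∪ edgeInF F v
    lost u a with adj-cases v∈ a
    ... | inj₁ e        = contradiction (trans (sym (edgeH-sym F e)) (isolated u)) λ ()
    ... | inj₂ (inj₁ e) = ∨-trueˡ _ e
    ... | inj₂ (inj₂ e) = ∨-trueʳ (vdel F u) e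

  -- By inclusion-exclusion and `sparse`, two vertices of `S` have at least `d + 3` neighbours in
  -- `G` altogether. Faults destroy at most `size F + 1` of them by this count, a deleted edge
  -- between the two vertices being charged twice. The codegree is added on both sides and
  -- cancelled.
  pair-expansion : Cubelike d G → ∀ S → S ⊆ alive F → 2 ≤ count S →
    2 + d ≤ size F + count (nbhd (edgeH F) S)
  pair-expansion {d} cube S S⊆ 2≤ with two-elements S 2≤
  ... | u , v , u≢v , u∈ , v∈ = +-cancelˡ-≤ (suc cod) _ _ (begin
    suc cod + (2 + d)                          ≡⟨ rearrange₁ cod d ⟩
    (3 + cod) + d                              ≤⟨ +-monoˡ-≤ d (sparse u v u≢v) ⟩
    d + d                                      ≡⟨ sym (cong₂ _+_ (row u) (row v)) ⟩
    count A + count B                          ≡⟨ sym (count-∪-∩ A B) ⟩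
    count (A ∪ B) + cod                        ≤⟨ +-monoˡ-≤ cod (≤-trans
      (count-subadd {p = A ∪ B} {T} {vdel F ∪ (edgeInF F u ∪ edgeInF F v)} covered)
      (+-monoʳ-≤ (count T) (≤-trans (count-∪ (vdel F) _) (+-monoʳ-≤ (nV F)
        (≤-trans (count-∪ (edgeInF F u) (edgeInF F v))
          (two-stars≤upper (edgeInF F) edgeInF-sym edgeInF-irr u v u≢v)))))) ⟩
    (count T + (nV F + suc (upper (edgeInF F)))) + cod  ≡⟨ rearrange₂ (count T) (nV F) (upper (edgeInF F)) cod ⟩
    suc cod + (size F + count T)               ∎)
    where
    open ≤-Reasoning
    open Cubelike cube
    cod = codegree G u v
    row : ∀ v → count (adj G v) ≡ d
    row v = trans (sym (degree-row G v)) (regular v)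
    A = adj G u
    B = adj G v
    T = nbhd (edgeH F) S
    rearrange₁ : ∀ c d → suc c + (2 + d) ≡ (3 + c) + d
    rearrange₁ = solve-∀
    rearrange₂ : ∀ t v e c → (t + (v + suc e)) + c ≡ suc c + ((v + e) + t)
    rearrange₂ = solve-∀
    cover : ∀ {w} z → w ∈ S → adj G w z ≡ true → z ∈ T ⊎ (z ∈ vdel F ⊎ edgeInF F w z ≡ true)
    cover z w∈ a with adj-cases (S⊆ _ w∈) a
    ... | inj₁ e = inj₁ (nbhd⁺ (edgeH F) S w∈ e)
    ... | inj₂ f = inj₂ f
    covered : A ∪ B ⊆ T ∪ (vdel F ∪ (edgeInF F u ∪ edgeInF F v))
    covered z z∈ with ∨-true⁻ (A z) z∈
    ... | inj₁ a with cover z u∈ a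
    ...   | inj₁ t        = ∨-trueˡ _ t
    ...   | inj₂ (inj₁ x) = ∨-trueʳ (T z) (∨-trueˡ _ x)
    ...   | inj₂ (inj₂ e) = ∨-trueʳ (T z) (∨-trueʳ (vdel F z) (∨-trueˡ _ e))
    covered z z∈ | inj₂ b with cover z v∈ b
    ...   | inj₁ t        = ∨-trueˡ _ t
    ...   | inj₂ (inj₁ x) = ∨-trueʳ (T z) (∨-trueˡ _ x)
    ...   | inj₂ (inj₂ e) = ∨-trueʳ (T z) (∨-trueʳ (vdel F z) (∨-trueʳ (edgeInF F u z) e))

-- Deficit and surplus of a resilient graph.

module _ {G : Graph} (resilient : Resilient d G) where

  -- Restoring a deleted edge ab costs two: a is dropped from S, and may enter the neighbourhood.
  deficiency : 1 ≤ d → ∀ e (F : DelSet G) S → S ⊆ alive F → size F < d + e →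
    count S ≤ count (nbhd (edgeH F) S) + 2 * e
  deficiency 1≤d zero F S S⊆ small =
    ≤-trans (resilient F (subst (size F <_) (+-identityʳ d) small) S S⊆) (m≤m+n _ _)
  deficiency 1≤d (suc e) F S S⊆ small with 1 ≤? size F
  ... | no none = ≤-trans (resilient F (≤-trans (≰⇒> none) 1≤d) S S⊆) (m≤m+n _ _)
  ... | yes some with some-fault F some
  ...   | inj₁ (x , x∈) = begin
    count S                      ≤⟨ deficiency 1≤d e F′ S alive′ small′ ⟩
    count (nbhd (edgeH F′) S) + 2 * e  ≤⟨ +-monoˡ-≤ (2 * e)
        (≤-trans (count-subadd {q = T} {⟦ x ⟧} (nbhd-restore-vertex F x S S⊆)) (≤-reflexive (cong (count T +_) (count-⟦⟧ x)))) ⟩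
    -- A restored vertex adds one neighbour and removes nothing from `S`; the bound is rounded up to
    -- the price of an edge.
    (count T + 1) + 2 * e        ≤⟨ n≤1+n _ ⟩
    suc ((count T + 1) + 2 * e)  ≡⟨ rearrange (count T) e ⟩
    count T + 2 * suc e          ∎
    where
    open ≤-Reasoning
    F′ = restore-vertex F x
    T = nbhd (edgeH F) S
    rearrange : ∀ t e → suc ((t + 1) + 2 * e) ≡ t + 2 * suc e
    rearrange = solve-∀
    alive′ : S ⊆ alive F′
    alive′ v v∈ = not-true λ dead → not-true⁻ (S⊆ v v∈) (∖⊆ (vdel F) x v dead)
    small′ : size F′ < d + e
    small′ = ≤-trans (size-restore-vertex F x x∈) (s≤s⁻¹ (subst (size F <_) (+-suc d e) small))
  ...   | inj₂ (a , b , ab) = begin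
    count S                      ≤⟨ count-∖ S a ⟩
    suc (count (S ∖ a))          ≤⟨ s≤s (deficiency 1≤d e F′ (S ∖ a) (λ v v∈ → S⊆ v (∖⊆ S a v v∈)) small′) ⟩
    suc (count (nbhd (edgeH F′) (S ∖ a)) + 2 * e)  ≤⟨ s≤s (+-monoˡ-≤ (2 * e)
        (≤-trans (count-subadd {q = T} {⟦ a ⟧} (nbhd-restore-edge F a b S)) (≤-reflexive (cong (count T +_) (count-⟦⟧ a))))) ⟩
    suc ((count T + 1) + 2 * e)  ≡⟨ rearrange (count T) e ⟩
    count T + 2 * suc e          ∎
    where
    open ≤-Reasoning
    F′ = restore-edge F a b
    T = nbhd (edgeH F) S
    rearrange : ∀ t e → suc ((t + 1) + 2 * e) ≡ t + 2 * suc e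
    rearrange = solve-∀
    small′ : size F′ < d + e
    small′ = ≤-trans (size-restore-edge F a b ab) (s≤s⁻¹ (subst (size F <_) (+-suc d e) small))

  -- An independent S misses its neighbourhood, so neighbours of S can be deleted one by one
  -- until the fault budget is used up.
  surplus : ∀ k (F : DelSet G) S → S ⊆ alive F → Independent F S → 1 ≤ count S → size F + k < d →
    count S + k ≤ count (nbhd (edgeH F) S)
  surplus zero F S S⊆ ind 1≤ small = subst (_≤ count (nbhd (edgeH F) S)) (sym (+-identityʳ _))
    (resilient F (subst (_< d) (+-identityʳ _) small) S S⊆)
  surplus (suc k) F S S⊆ ind 1≤ small
    with count-pos⁻ (nbhd (edgeH F) S)
           (≤-trans 1≤ (resilient F (≤-trans (s≤s (m≤m+n _ (suc k))) small) S S⊆))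
  ... | x , x∈T = begin
    count S + suc k                   ≡⟨ +-suc (count S) k ⟩
    suc (count S + k)                 ≤⟨ s≤s (surplus k F′ S alive′ ind′ 1≤ small′) ⟩
    suc (count (nbhd (edgeH F′) S))   ≤⟨ s≤s (count-mono shrink) ⟩
    suc (count (T ∖ x))               ≤⟨ ∖-count T x∈T ⟩
    count T                           ∎
    where
    open ≤-Reasoning
    F′ = delete-vertex F x
    T = nbhd (edgeH F) S
    -- Independence keeps the deleted neighbour out of `S`, so `S` still consists of survivors of
    -- `F′`.
    x∉S : ¬ x ∈ S
    x∉S x∈S = let v , v∈S , e = nbhd⁻ (edgeH F) S x∈T in ind v x v∈S x∈S e
    alive′ : S ⊆ alive F′
    alive′ v v∈ = not-true λ dead → case (∨-true⁻ (vdel F v) dead)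
      where
      case : ¬ (v ∈ vdel F ⊎ v ∈ ⟦ x ⟧)
      case (inj₁ e) = not-true⁻ (S⊆ v v∈) e
      case (inj₂ e) = x∉S (subst (_∈ S) (sym (does-true (x ≟ v) e)) v∈)
    revive : ∀ {v} → v ∈ alive F′ → v ∈ alive F
    revive {v} v∈ = not-true λ dead → not-true⁻ v∈ (∨-trueˡ _ dead)
    edge⁻ : ∀ u v → edgeH F′ u v ≡ true → edgeH F u v ≡ true
    edge⁻ u v e = edgeH⁺ F (revive (edgeH-aliveˡ F′ {u} {v} e)) (revive (edgeH-aliveʳ F′ {u} {v} e))
      (edgeH-adj F′ {u} {v} e) (edgeH-kept F′ {u} {v} e)
    ind′ : Independent F′ S
    ind′ u v u∈ v∈ e = ind u v u∈ v∈ (edge⁻ u v e)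
    shrink : nbhd (edgeH F′) S ⊆ T ∖ x
    shrink v v∈ with nbhd⁻ (edgeH F′) S v∈
    ... | u , u∈S , e = ∈∖ T {x} (nbhd⁺ (edgeH F) S u∈S (edge⁻ u v e)) λ x≡v →
      not-true⁻ (edgeH-aliveʳ F′ {u} {v} e) (∨-trueʳ (vdel F v) (dec-true (x ≟ v) x≡v))
    small′ : size F′ + k < d
    small′ = ≤-trans (s≤s (≤-trans (+-monoˡ-≤ k (size-delete-vertex F x)) (≤-reflexive (sym (+-suc (size F) k))))) small

-- The cross matching, and the balance between the halves.

-- Double counting of the `M`-edges that end in `T ∪ V`: each vertex of `S` has such an edge or one
-- in `E`, and no end is used twice. In the application `T` holds the neighbours of `S` in the
-- opposite half, `V` its dead vertices, and `E` the deleted cross edges.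
crossing : (M E : Rel k n) → (∀ x → 1 ≤ count (M x)) → (∀ y → count (λ x → M x y) ≤ 1) →
  (S : FinSet k) (T V : FinSet n) →
  (∀ x y → x ∈ S → M x y ≡ true → y ∈ T ∪ V ⊎ E x y ≡ true) →
  count S ≤ count T + count V + sumℕ (λ x → count (E x))
crossing {k} {n} M E rows columns S T V escape = begin
  count S                                                        ≡⟨ count≡sum S ⟩
  sumℕ (bit ∘ S)                                                 ≤⟨ sumℕ-mono row ⟩
  sumℕ (λ x → count (Q x) + count (E x))                         ≡⟨ sumℕ-+ (count ∘ Q) (count ∘ E) ⟩
  sumℕ (λ x → count (Q x)) + ΣE                                  ≡⟨ cong (_+ ΣE) (count-swap Q) ⟩
  sumℕ (λ y → count (λ x → Q x y)) + ΣE                          ≤⟨ +-monoˡ-≤ ΣE (sumℕ-mono column) ⟩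
  sumℕ (bit ∘ (T ∪ V)) + ΣE                                      ≡⟨ cong (_+ ΣE) (sym (count≡sum (T ∪ V))) ⟩
  count (T ∪ V) + ΣE                                             ≤⟨ +-monoˡ-≤ ΣE (count-∪ T V) ⟩
  count T + count V + ΣE                                         ∎
  where
  open ≤-Reasoning
  ΣE = sumℕ (λ x → count (E x))
  Q : Rel k n
  Q x y = M x y ∧ (T ∪ V) y
  row : ∀ x → bit (S x) ≤ count (Q x) + count (E x)
  row x with S x in eq
  ... | false = z≤n
  ... | true  = ≤-trans (rows x) (count-subadd {p = M x} {Q x} {E x} out)
    where
    out : M x ⊆ Q x ∪ E x
    out y xMy with escape x y eq xMy
    ... | inj₁ y∈ = ∨-trueˡ _ (∧-true xMy y∈)
    ... | inj₂ e  = ∨-trueʳ (Q x y) e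
  column : ∀ y → count (λ x → Q x y) ≤ bit ((T ∪ V) y)
  column y with (T ∪ V) y in eq
  ... | true  = ≤-trans (count-mono (λ x → ∧-conicalˡ (M x y) _)) (columns y)
  ... | false = ≤-trans (count-mono {q = λ _ → false} (λ x e → ∧-conicalʳ (M x y) _ e))
                  (≤-reflexive (count-false {k}))

-- d is the valency of a half, s its number of faults, i the number of vertices of S in it and
-- n the number of neighbours of S in it.
record Side (d s i n : ℕ) : Set where
  field
    deficit : ∀ e → s < d + e → i ≤ n + 2 * e
    excess  : 1 ≤ i → ∀ k → s + k < d → i + k ≤ n
    pair    : 2 ≤ i → 2 + d ≤ s + n

-- The first half is the one with at least as many faults. If `S` avoids the second half, the cross
-- matching or the absence of isolated vertices decides; otherwise the second half pays for the
-- first.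
balance-≤ : ∀ {d s₁ s₂ c i₁ i₂ n₁ n₂} → 7 ≤ d → s₁ + s₂ + c ≤ 2 + d →
  Side d s₁ i₁ n₁ → Side d s₂ i₂ n₂ → i₁ ≤ n₂ + s₂ + c →
  (1 ≤ i₁ + i₂ → 1 ≤ n₁ + n₂) → s₂ ≤ s₁ → i₁ + i₂ ≤ n₁ + n₂
balance-≤ {i₁ = zero} {i₂ = zero} _ _ _ _ _ _ _ = z≤n
-- A lone vertex is the only case that relies on there being no isolated vertex.
balance-≤ {i₁ = suc zero} {i₂ = zero} _ _ _ _ _ one _ = one (s≤s z≤n)
-- The matching loses at most `s₂ + c`. Since the total is at most `2 + d`, the bound `pair` gives
-- `s₂ + c ≤ n₁`, so neighbours within the first half make up the loss.
balance-≤ {d} {s₁} {s₂} {c} {i₁@(suc (suc _))} {zero} {n₁} {n₂} _ total side₁ _ cross _ _ = begin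
  i₁ + 0          ≡⟨ +-identityʳ i₁ ⟩
  i₁              ≤⟨ cross ⟩
  n₂ + s₂ + c     ≡⟨ +-assoc n₂ s₂ c ⟩
  n₂ + (s₂ + c)   ≤⟨ +-monoʳ-≤ n₂ (+-cancelˡ-≤ s₁ _ _ (begin
      s₁ + (s₂ + c)  ≡⟨ sym (+-assoc s₁ s₂ c) ⟩
      s₁ + s₂ + c    ≤⟨ total ⟩
      2 + d          ≤⟨ Side.pair side₁ (s≤s (s≤s z≤n)) ⟩
      s₁ + n₁        ∎)) ⟩
  n₂ + n₁         ≡⟨ +-comm n₂ n₁ ⟩
  n₁ + n₂         ∎
  where open ≤-Reasoning
balance-≤ {d} {s₁} {s₂} {c} {i₁} {i₂@(suc _)} {n₁} {n₂} 7≤d total side₁ side₂ cross _ s₂≤s₁ with suc s₁ ≤? d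
... | yes s₁<d = subst₂ (λ a b → i₁ + i₂ ≤ a + b) (+-identityʳ n₁) (+-identityʳ n₂) (+-mono-≤
    (Side.deficit side₁ 0 (≤-trans s₁<d (m≤m+n d 0)))
    (Side.deficit side₂ 0 (≤-trans (s≤s s₂≤s₁) (≤-trans s₁<d (m≤m+n d 0)))))
-- Now `s₁ = d + j`, which leaves `j + s₂ ≤ 2`. The deficit of the first half is at most
-- `2 * suc j`, and the second half has that much surplus.
... | no s₁≮d with m≤n⇒∃[o]m+o≡n (≮⇒≥ s₁≮d)
...   | j , refl = begin
  i₁ + i₂                   ≤⟨ +-monoˡ-≤ i₂ (Side.deficit side₁ (suc j) (≤-reflexive (sym (+-suc d j)))) ⟩
  (n₁ + 2 * suc j) + i₂     ≡⟨ +-assoc n₁ _ _ ⟩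
  n₁ + (2 * suc j + i₂)     ≡⟨ cong (n₁ +_) (+-comm _ i₂) ⟩
  n₁ + (i₂ + 2 * suc j)     ≤⟨ +-monoʳ-≤ n₁ (Side.excess side₂ (s≤s z≤n) (2 * suc j) room) ⟩
  n₁ + n₂                   ∎
  where
  open ≤-Reasoning
  few : j + s₂ ≤ 2
  few = +-cancelˡ-≤ d _ _ (begin
    d + (j + s₂)      ≡⟨ sym (+-assoc d j s₂) ⟩
    d + j + s₂        ≤⟨ m≤m+n _ c ⟩
    d + j + s₂ + c    ≤⟨ total ⟩
    2 + d             ≡⟨ +-comm 2 d ⟩
    d + 2             ∎)
  rearrange : ∀ j s → suc (s + 2 * suc j) ≡ (j + s) + (3 + j)
  rearrange = solve-∀
  -- Tight for `j = 2`, `s₂ = 0`, where a surplus of six is called for: this is where `7 ≤ d` comes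
  -- from.
  room : s₂ + 2 * suc j < d
  room = begin
    suc (s₂ + 2 * suc j)   ≡⟨ rearrange j s₂ ⟩
    (j + s₂) + (3 + j)     ≤⟨ +-mono-≤ few (+-monoʳ-≤ 3 (≤-trans (m≤m+n j s₂) few)) ⟩
    7                      ≤⟨ 7≤d ⟩
    d                      ∎

balance : ∀ {d s₁ s₂ c i₁ i₂ n₁ n₂} → 7 ≤ d → s₁ + s₂ + c ≤ 2 + d →
  Side d s₁ i₁ n₁ → Side d s₂ i₂ n₂ → i₁ ≤ n₂ + s₂ + c → i₂ ≤ n₁ + s₁ + c →
  (1 ≤ i₁ + i₂ → 1 ≤ n₁ + n₂) → i₁ + i₂ ≤ n₁ + n₂
balance {d} {s₁} {s₂} {c} {i₁} {i₂} {n₁} {n₂} 7≤d total side₁ side₂ cross₁ cross₂ one with ≤-total s₂ s₁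
... | inj₁ s₂≤s₁ = balance-≤ 7≤d total side₁ side₂ cross₁ one s₂≤s₁
... | inj₂ s₁≤s₂ = subst₂ _≤_ (+-comm i₂ i₁) (+-comm n₂ n₁)
  (balance-≤ 7≤d (subst (λ s → s + c ≤ 2 + d) (+-comm s₁ s₂) total) side₂ side₁ cross₂
    (subst₂ (λ a b → 1 ≤ a → 1 ≤ b) (+-comm i₁ i₂) (+-comm n₁ n₂) one) s₁≤s₂)

-- Joins of two graphs

↑-elim : ∀ k {n} (P : Fin (k + n) → Set) → (∀ i → P (i ↑ˡ n)) → (∀ j → P (k ↑ʳ j)) → ∀ v → P v
↑-elim k {n} P l r v = subst P (join-splitAt k n v) (go (splitAt k v))
  where
  go : ∀ s → P (join k n s)
  go (inj₁ i) = l i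
  go (inj₂ j) = r j

⌊<⌋-mono : ∀ {k n} {i j : Fin k} {i′ j′ : Fin n} → (toℕ i < toℕ j → toℕ i′ < toℕ j′) →
  ⌊ i <? j ⌋ ≡ true → ⌊ i′ <? j′ ⌋ ≡ true
⌊<⌋-mono {i = i} {j} {i′} {j′} h e = trans (isYes≗does (i′ <? j′))
  (dec-true (i′ <? j′) (h (does-true (i <? j) (trans (sym (isYes≗does (i <? j))) e))))

module Join (G₁ G₂ : Graph) (c : Rel (N G₁) (N G₂)) where

  G : Graph
  G = joinG G₁ G₂ c

  inl : Fin (N G₁) → Fin (N G)
  inl i = i ↑ˡ N G₂

  inr : Fin (N G₂) → Fin (N G)
  inr j = N G₁ ↑ʳ j

  adj-ll : ∀ i j → adj G (inl i) (inl j) ≡ adj G₁ i j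
  adj-ll i j rewrite splitAt-↑ˡ (N G₁) i (N G₂) | splitAt-↑ˡ (N G₁) j (N G₂) = refl

  adj-lr : ∀ i j → adj G (inl i) (inr j) ≡ c i j
  adj-lr i j rewrite splitAt-↑ˡ (N G₁) i (N G₂) | splitAt-↑ʳ (N G₁) (N G₂) j = refl

  adj-rl : ∀ i j → adj G (inr j) (inl i) ≡ c i j
  adj-rl i j rewrite splitAt-↑ˡ (N G₁) i (N G₂) | splitAt-↑ʳ (N G₁) (N G₂) j = refl

  adj-rr : ∀ i j → adj G (inr i) (inr j) ≡ adj G₂ i j
  adj-rr i j rewrite splitAt-↑ʳ (N G₁) (N G₂) i | splitAt-↑ʳ (N G₁) (N G₂) j = refl

  -- Within one half, passing to the join adds at most two common neighbours, matching the two added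
  -- to the valency. Across the halves, a common neighbour is a cross partner of one of the two
  -- vertices, so there are at most four, and `7 ≤ d` suffices.
  cubelike : 7 ≤ d → Cubelike d G₁ → Cubelike d G₂ →
    (∀ i → count (c i) ≡ 2) → (∀ j → count (λ i → c i j) ≡ 2) → Cubelike (2 + d) G
  cubelike {d} 7≤d cube₁ cube₂ rows columns = record
    { nonempty = ≤-trans (Cubelike.nonempty cube₁) (m≤m+n _ _)
    ; regular  = ↑-elim (N G₁) (λ v → degree G v ≡ 2 + d)
        (λ i → begin
          degree G (inl i)             ≡⟨ count-split (N G₁) (λ u → adj G u (inl i)) ⟩
          count (λ j → adj G (inl j) (inl i)) + count (λ j → adj G (inr j) (inl i))
            ≡⟨ cong₂ _+_ (count-cong λ j → adj-ll j i) (count-cong λ j → adj-rl i j) ⟩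
          degree G₁ i + count (c i)    ≡⟨ cong₂ _+_ (Cubelike.regular cube₁ i) (rows i) ⟩
          d + 2                        ≡⟨ +-comm d 2 ⟩
          2 + d                        ∎)
        (λ j → begin
          degree G (inr j)             ≡⟨ count-split (N G₁) (λ u → adj G u (inr j)) ⟩
          count (λ i → adj G (inl i) (inr j)) + count (λ i → adj G (inr i) (inr j))
            ≡⟨ cong₂ _+_ (count-cong λ i → adj-lr i j) (count-cong λ i → adj-rr i j) ⟩
          count (λ i → c i j) + degree G₂ j    ≡⟨ cong₂ _+_ (columns j) (Cubelike.regular cube₂ j) ⟩
          2 + d                        ∎)
    ; sparse = ↑-elim (N G₁) (λ u → ∀ v → u ≢ v → 3 + codegree G u v ≤ 2 + d)
        (λ i → ↑-elim (N G₁) (λ v → inl i ≢ v → 3 + codegree G (inl i) v ≤ 2 + d)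
          (λ i′ ne → same cube₁ i i′ (ne ∘ cong inl) (≤-trans (≤-reflexive (ll i i′))
            (+-monoʳ-≤ (codegree G₁ i i′)
              (≤-trans (count-mono λ j → ∧-conicalˡ (c i j) _) (≤-reflexive (rows i))))))
          (λ j _ → across i j (inl i) (inr j) (lr i j)))
        (λ j → ↑-elim (N G₁) (λ v → inr j ≢ v → 3 + codegree G (inr j) v ≤ 2 + d)
          (λ i _ → across i j (inr j) (inl i)
            (trans (count-cong λ w → ∧-comm (adj G (inr j) w) (adj G (inl i) w)) (lr i j)))
          (λ j′ ne → same cube₂ j j′ (ne ∘ cong inr) (≤-trans (≤-reflexive (rr j j′))
            (≤-trans (+-monoˡ-≤ (codegree G₂ j j′)
              (≤-trans (count-mono λ i → ∧-conicalˡ (c i j) _) (≤-reflexive (columns j))))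
              (≤-reflexive (+-comm 2 _))))))
    }
    where
    open ≡-Reasoning
    ll : ∀ i i′ → codegree G (inl i) (inl i′) ≡ codegree G₁ i i′ + count (λ j → c i j ∧ c i′ j)
    ll i i′ = trans (count-split (N G₁) _) (cong₂ _+_
      (count-cong λ w → cong₂ _∧_ (adj-ll i w) (adj-ll i′ w))
      (count-cong λ w → cong₂ _∧_ (adj-lr i w) (adj-lr i′ w)))
    rr : ∀ j j′ → codegree G (inr j) (inr j′) ≡ count (λ i → c i j ∧ c i j′) + codegree G₂ j j′
    rr j j′ = trans (count-split (N G₁) _) (cong₂ _+_
      (count-cong λ w → cong₂ _∧_ (adj-rl w j) (adj-rl w j′))
      (count-cong λ w → cong₂ _∧_ (adj-rr j w) (adj-rr j′ w)))
    lr : ∀ i j → codegree G (inl i) (inr j) ≡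
      count (λ w → adj G₁ i w ∧ c w j) + count (λ w → c i w ∧ adj G₂ j w)
    lr i j = trans (count-split (N G₁) _) (cong₂ _+_
      (count-cong λ w → cong₂ _∧_ (adj-ll i w) (adj-rl w j))
      (count-cong λ w → cong₂ _∧_ (adj-lr i w) (adj-rr j w)))
    same : ∀ {H} → Cubelike d H → ∀ u v → u ≢ v → ∀ {m} → m ≤ codegree H u v + 2 → 3 + m ≤ 2 + d
    same {H} cube u v u≢v m≤ = ≤-trans (+-monoʳ-≤ 3 m≤) (≤-trans
      (≤-reflexive (trans (sym (+-assoc 3 (codegree H u v) 2)) (+-comm _ 2)))
      (+-monoʳ-≤ 2 (Cubelike.sparse cube u v u≢v)))
    across : ∀ i j u v → codegree G u v ≡
      count (λ w → adj G₁ i w ∧ c w j) + count (λ w → c i w ∧ adj G₂ j w) → 3 + codegree G u v ≤ 2 + d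
    across i j u v eq rewrite eq = ≤-trans (+-monoʳ-≤ 3 (+-mono-≤
      (≤-trans (count-mono λ w → ∧-conicalʳ (adj G₁ i w) _) (≤-reflexive (columns j)))
      (≤-trans (count-mono λ w → ∧-conicalˡ (c i w) _) (≤-reflexive (rows i)))))
      (≤-trans 7≤d (m≤n+m d 2))

  -- Faults of a join: the two halves and the cross edges.

  module _ (F : DelSet G) where

    left : DelSet G₁
    left = record { vdel = vdel F ∘ inl ; edel = λ u v → edel F (inl u) (inl v) }

    right : DelSet G₂
    right = record { vdel = vdel F ∘ inr ; edel = λ u v → edel F (inr u) (inr v) }

    crossFaults : ℕ
    crossFaults = sumℕ λ i → count λ j → edgeInF F (inl i) (inr j)

    -- Left indices precede right ones, so the upper triangle of the join contains the triangles of
    -- both halves and the full block of cross pairs.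
    size-split : size left + size right + crossFaults ≤ size F
    size-split = begin
      size left + size right + crossFaults
        ≡⟨ rearrange (nV left) (upper (edgeInF left)) (nV right) (upper (edgeInF right)) crossFaults ⟩
      (nV left + nV right) + ((upper (edgeInF left) + crossFaults) + upper (edgeInF right))
        ≤⟨ +-mono-≤ (≤-reflexive (sym (count-split (N G₁) (vdel F)))) edges ⟩
      size F ∎
      where
      open ≤-Reasoning
      rearrange : ∀ a b c d e → ((a + b) + (c + d)) + e ≡ (a + c) + ((b + e) + d)
      rearrange = solve-∀
      row : Fin (N G) → FinSet (N G)
      row u v = ⌊ u <? v ⌋ ∧ edgeInF F u v
      ll : ∀ i j → ⌊ i <? j ⌋ ∧ edgeInF left i j ≡ true → row (inl i) (inl j) ≡ true
      ll i j e = ∧-true (⌊<⌋-mono {i = i} {j} {inl i} {inl j} (subst₂ _<_ (sym (toℕ-↑ˡ i _)) (sym (toℕ-↑ˡ j _)))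
          (∧-conicalˡ ⌊ i <? j ⌋ _ e))
        (trans (cong (_∧ _) (adj-ll i j)) (∧-conicalʳ ⌊ i <? j ⌋ _ e))
      rr : ∀ i j → ⌊ i <? j ⌋ ∧ edgeInF right i j ≡ true → row (inr i) (inr j) ≡ true
      rr i j e = ∧-true (⌊<⌋-mono {i = i} {j} {inr i} {inr j}
          (subst₂ _<_ (sym (toℕ-↑ʳ (N G₁) i)) (sym (toℕ-↑ʳ (N G₁) j)) ∘ +-monoʳ-< (N G₁))
          (∧-conicalˡ ⌊ i <? j ⌋ _ e))
        (trans (cong (_∧ _) (adj-rr i j)) (∧-conicalʳ ⌊ i <? j ⌋ _ e))
      lr : ∀ i j → edgeInF F (inl i) (inr j) ≡ true → row (inl i) (inr j) ≡ true
      lr i j e = ∧-true (trans (isYes≗does (inl i <? inr j)) (dec-true (inl i <? inr j)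
        (subst₂ _<_ (sym (toℕ-↑ˡ i _)) (sym (toℕ-↑ʳ (N G₁) j)) (≤-trans (toℕ<n i) (m≤m+n _ _))))) e
      edges : (upper (edgeInF left) + crossFaults) + upper (edgeInF right) ≤ upper (edgeInF F)
      edges = begin
        (upper (edgeInF left) + crossFaults) + upper (edgeInF right)
          ≡⟨ cong (_+ upper (edgeInF right)) (sym (sumℕ-+ _ (λ i → count λ j → edgeInF F (inl i) (inr j)))) ⟩
        sumℕ (λ i → count (λ j → ⌊ i <? j ⌋ ∧ edgeInF left i j) + count (λ j → edgeInF F (inl i) (inr j)))
          + upper (edgeInF right)
          ≤⟨ +-mono-≤
              (sumℕ-mono λ i → ≤-trans (+-mono-≤ (count-mono (ll i)) (count-mono (lr i)))
                (≤-reflexive (sym (count-split (N G₁) (row (inl i))))))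
              (sumℕ-mono λ i → ≤-trans (count-mono (rr i)) (≤-trans (m≤n+m _ _)
                (≤-reflexive (sym (count-split (N G₁) (row (inr i))))))) ⟩
        sumℕ (λ i → count (row (inl i))) + sumℕ (λ j → count (row (inr j)))
          ≡⟨ sym (sumℕ-split (N G₁) (λ u → count (row u))) ⟩
        upper (edgeInF F) ∎

    edgeH-left : ∀ i j → edgeH F (inl i) (inl j) ≡ edgeH left i j
    edgeH-left i j = cong (λ a → alive left i ∧ (alive left j ∧ (a ∧ not (edel F (inl i) (inl j) ∨ edel F (inl j) (inl i))))) (adj-ll i j)

    edgeH-right : ∀ i j → edgeH F (inr i) (inr j) ≡ edgeH right i j
    edgeH-right i j = cong (λ a → alive right i ∧ (alive right j ∧ (a ∧ not (edel F (inr i) (inr j) ∨ edel F (inr j) (inr i))))) (adj-rr i j)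

    module _ (7≤d : 7 ≤ d) (cube₁ : Cubelike d G₁) (cube₂ : Cubelike d G₂)
             (resilient₁ : Resilient d G₁) (resilient₂ : Resilient d G₂)
             (M : Rel (N G₁) (N G₂)) (M⊆c : ∀ {i j} → M i j ≡ true → c i j ≡ true)
             (perfect : IsPerfectBetween M)
             (few : size F ≤ 2 + d) (no-isolated : ¬ HasIsolated F) where

      -- `S` is cut along the halves. Each piece is independent in its half, and its neighbours
      -- there are part of `T`, so the one-half bounds supply both `Side` records; `crossing`,
      -- applied in both directions, supplies the rest of `balance`.
      independent-expands : ∀ S → S ⊆ alive F → Independent F S → count S ≤ count (nbhd (edgeH F) S)
      independent-expands S S⊆ independent =
        subst₂ _≤_ (sym (count-split (N G₁) S)) (sym (count-split (N G₁) T))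
          (balance 7≤d (≤-trans size-split few) side₁ side₂ cross₁ cross₂ reach)
        where
        S₁ = S ∘ inl
        S₂ = S ∘ inr
        T = nbhd (edgeH F) S
        T₁ = T ∘ inl
        T₂ = T ∘ inr
        left⊆ : nbhd (edgeH left) S₁ ⊆ T₁
        left⊆ j j∈ = let i , i∈ , e = nbhd⁻ (edgeH left) S₁ j∈ in
          nbhd⁺ (edgeH F) S i∈ (trans (edgeH-left i j) e)
        right⊆ : nbhd (edgeH right) S₂ ⊆ T₂
        right⊆ j j∈ = let i , i∈ , e = nbhd⁻ (edgeH right) S₂ j∈ in
          nbhd⁺ (edgeH F) S i∈ (trans (edgeH-right i j) e)
        S₁⊆ : S₁ ⊆ alive left
        S₁⊆ i = S⊆ (inl i)
        S₂⊆ : S₂ ⊆ alive right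
        S₂⊆ i = S⊆ (inr i)
        side : ∀ {H} → Cubelike d H → Resilient d H → (F′ : DelSet H) → ∀ S′ {T′} →
          S′ ⊆ alive F′ → Independent F′ S′ → nbhd (edgeH F′) S′ ⊆ T′ → Side d (size F′) (count S′) (count T′)
        side cube resilient F′ S′ {T′} alive′ independent′ ⊆T′ = record
          { deficit = λ e small → ≤-trans
              (deficiency resilient (≤-trans (s≤s z≤n) 7≤d) e F′ S′ alive′ small) (+-monoˡ-≤ (2 * e) grow)
          ; excess  = λ 1≤ k small → ≤-trans (surplus resilient k F′ S′ alive′ independent′ 1≤ small) grow
          ; pair    = λ 2≤ → ≤-trans (pair-expansion F′ cube S′ alive′ 2≤) (+-monoʳ-≤ (size F′) grow)
          }
          where
          grow : count (nbhd (edgeH F′) S′) ≤ count T′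
          grow = count-mono ⊆T′
        side₁ = side cube₁ resilient₁ left S₁ S₁⊆
          (λ u v u∈ v∈ e → independent (inl u) (inl v) u∈ v∈ (trans (edgeH-left u v) e)) left⊆
        side₂ = side cube₂ resilient₂ right S₂ S₂⊆
          (λ u v u∈ v∈ e → independent (inr u) (inr v) u∈ v∈ (trans (edgeH-right u v) e)) right⊆
        escape : ∀ u v → u ∈ S → adj G u v ≡ true → v ∈ T ∪ vdel F ⊎ edgeInF F u v ≡ true
        escape u v u∈ a with adj-cases F (S⊆ u u∈) a
        ... | inj₁ e        = inj₁ (∨-trueˡ _ (nbhd⁺ (edgeH F) S u∈ e))
        ... | inj₂ (inj₁ x) = inj₁ (∨-trueʳ (T v) x)
        ... | inj₂ (inj₂ e) = inj₂ e
        cross₁ : count S₁ ≤ count T₂ + size right + crossFaults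
        cross₁ = ≤-trans
          (crossing M (λ i j → edgeInF F (inl i) (inr j))
            (λ i → ≤-reflexive (sym (proj₁ perfect i))) (λ j → ≤-reflexive (proj₂ perfect j)) S₁ T₂ (vdel right)
            λ i j i∈ e → escape (inl i) (inr j) i∈ (trans (adj-lr i j) (M⊆c e)))
          (+-monoˡ-≤ crossFaults (+-monoʳ-≤ (count T₂) (m≤m+n (nV right) _)))
        cross₂ : count S₂ ≤ count T₁ + size left + crossFaults
        cross₂ = ≤-trans
          (crossing (λ j i → M i j) (λ j i → edgeInF F (inl i) (inr j))
            (λ j → ≤-reflexive (sym (proj₂ perfect j))) (λ i → ≤-reflexive (proj₁ perfect i)) S₂ T₁ (vdel left)
            λ j i j∈ e → flip (escape (inr j) (inl i) j∈ (trans (adj-rl i j) (M⊆c e))))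
          (+-mono-≤ (+-monoʳ-≤ (count T₁) (m≤m+n (nV left) _))
            (≤-reflexive (sym (count-swap (λ i j → edgeInF F (inl i) (inr j))))))
          where
          flip : ∀ {i j} {A : Set} → A ⊎ edgeInF F (inr j) (inl i) ≡ true → A ⊎ edgeInF F (inl i) (inr j) ≡ true
          flip (inj₁ a) = inj₁ a
          flip {i} {j} (inj₂ e) = inj₂ (trans (edgeInF-sym F (inl i) (inr j)) e)
        reach : 1 ≤ count S₁ + count S₂ → 1 ≤ count T₁ + count T₂
        reach 1≤ with count-pos⁻ S (subst (1 ≤_) (sym (count-split (N G₁) S)) 1≤)
        ... | v , v∈ = subst (1 ≤_) (count-split (N G₁) T) (decidable-stable (1 ≤? _) λ empty →
          no-isolated (v , S⊆ v v∈ , λ u → ¬-not λ e → empty (count-pos T (nbhd⁺ (edgeH F) S v∈ (edgeH-sym F e)))))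

-- It suffices to test Hall's condition on S ∖ N(S), which is independent.
hall-independent : ∀ {G} (F : DelSet G) →
  (∀ S → S ⊆ alive F → Independent F S → count S ≤ count (nbhd (edgeH F) S)) → Hall (alive F) (edgeH F)
hall-independent {G} F expands S S⊆ = begin
  count S                        ≡⟨ split S T ⟩
  count (S ∩ T) + count I        ≤⟨ +-mono-≤ (count-mono (λ v → trans (∧-comm (T v) (S v)))) (expands I I⊆ independent) ⟩
  count (T ∩ S) + count (nbhd (edgeH F) I)  ≤⟨ +-monoʳ-≤ (count (T ∩ S)) (count-mono I-nbhd) ⟩
  count (T ∩ S) + count (T ∩ (not ∘ S)) ≡⟨ sym (split T S) ⟩
  count T                        ∎
  where
  open ≤-Reasoning
  T = nbhd (edgeH F) S
  I = S ∩ (not ∘ T)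
  I⊆ : I ⊆ alive F
  I⊆ v v∈ = S⊆ v (∧-conicalˡ (S v) _ v∈)
  T∌I : ∀ {v} → v ∈ I → ¬ v ∈ T
  T∌I {v} v∈ = not-true⁻ (∧-conicalʳ (S v) _ v∈)
  independent : Independent F I
  independent u v u∈ v∈ e = T∌I v∈ (nbhd⁺ (edgeH F) S (∧-conicalˡ (S u) _ u∈) e)
  -- A neighbour of `I` inside `S` would put a vertex of `I` into `T`. So `I` expands into the part
  -- of `T` outside `S`, while the part common to `S` and `T` pays for itself.
  I-nbhd : nbhd (edgeH F) I ⊆ T ∩ (not ∘ S)
  I-nbhd v v∈ with nbhd⁻ (edgeH F) I v∈
  ... | u , u∈ , e = ∧-true (nbhd⁺ (edgeH F) S (∧-conicalˡ (S u) _ u∈) e)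
    (not-true λ v∈S → T∌I u∈ (nbhd⁺ (edgeH F) S v∈S (edgeH-sym F e)))
  split : ∀ {n} (p q : FinSet n) → count p ≡ count (p ∩ q) + count (p ∩ (not ∘ q))
  split {zero}  p q = refl
  split {suc n} p q = trans (cong₂ _+_ (bits (p zero) (q zero)) (split (p ∘ suc) (q ∘ suc)))
    (interchange +-commutativeSemigroup (bit (p zero ∧ q zero)) _ _ _)
    where
    bits : ∀ a b → bit a ≡ bit (a ∧ b) + bit (a ∧ not b)
    bits false b     = refl
    bits true  true  = refl
    bits true  false = refl

-- Generalized augmented cubes

min-over-constant : (f : Fin n → ℕ) → 1 ≤ n → (∀ i → f i ≡ d) → min-over f ≡ d
min-over-constant {suc zero}    f _ h = h zero
min-over-constant {suc (suc n)} {d} f _ h =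
  trans (cong₂ ℕ._⊓_ (h zero) (min-over-constant (f ∘ suc) (s≤s z≤n) (h ∘ suc))) (⊓-idem d)

δ-cubelike : ∀ {G} → Cubelike d G → δ G ≡ d
δ-cubelike {G = G} cube = min-over-constant (degree G) nonempty regular
  where open Cubelike cube

-- A violation of Hall's condition rules out a fractional perfect matching by `fpm⇒hall`, making `F`
-- an FSMP set with fewer than `δ G` elements.
resilient : ∀ {G} → Cubelike d G → FractionalStronglyMaximallyMatched G → Resilient d G
resilient {G = G} cube (_ , lower) F small S S⊆ = decidable-stable (_ ≤? _) λ violated →
  <⇒≱ small (subst (_≤ size F) (δ-cubelike cube) (lower F λ fpm → violated (fpm⇒hall F fpm S S⊆)))

∪-rows : (M₁ M₂ : Rel k n) → (∀ i → count (M₁ i) ≡ 1) → (∀ i → count (M₂ i) ≡ 1) → EdgeDisjoint M₁ M₂ →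
  ∀ i → count (λ j → M₁ i j ∨ M₂ i j) ≡ 2
∪-rows {n = n} M₁ M₂ rows₁ rows₂ disjoint i = begin
  count (M₁ i ∪ M₂ i)                          ≡⟨ sym (+-identityʳ _) ⟩
  count (M₁ i ∪ M₂ i) + 0                      ≡⟨ cong (count (M₁ i ∪ M₂ i) +_)
      (sym (trans (count-cong (disjoint i)) (count-false {n}))) ⟩
  count (M₁ i ∪ M₂ i) + count (M₁ i ∩ M₂ i)    ≡⟨ count-∪-∩ (M₁ i) (M₂ i) ⟩
  count (M₁ i) + count (M₂ i)                  ≡⟨ cong₂ _+_ (rows₁ i) (rows₂ i) ⟩
  2                                            ∎
  where open ≡-Reasoning

AQ₄-cubelike : Cubelike 7 (AQ 4)
AQ₄-cubelike = record
  { nonempty = s≤s z≤n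
  ; regular  = from-yes (all? λ u → degree (AQ 4) u ℕ.≟ 7)
  ; sparse   = from-yes (all? λ u → all? λ v → ¬? (u ≟ v) →-dec (3 + codegree (AQ 4) u v ≤? 7))
  }

module Step {G₁ G₂ : Graph} (M₁ M₂ : Rel (N G₁) (N G₂))
            (perfect₁ : IsPerfectBetween M₁) (perfect₂ : IsPerfectBetween M₂) (disjoint : EdgeDisjoint M₁ M₂) where

  c : Rel (N G₁) (N G₂)
  c i j = M₁ i j ∨ M₂ i j

  open Join G₁ G₂ c public

  c-rows : ∀ i → count (c i) ≡ 2
  c-rows = ∪-rows M₁ M₂ (proj₁ perfect₁) (proj₁ perfect₂) disjoint

  c-columns : ∀ j → count (λ i → c i j) ≡ 2
  c-columns = ∪-rows (λ j i → M₁ i j) (λ j i → M₂ i j) (proj₂ perfect₁) (proj₂ perfect₂) (λ j i → disjoint i j)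

-- The valency `2n - 1`, written with `n = 4 + j` so that it is visibly at least seven and both
-- halves get the same `j`.
GAQ-cubelike : ∀ {G} → GAQ n G → ∃ λ j → n ≡ 4 + j × Cubelike (7 + j * 2) G
GAQ-cubelike gaq4 = 0 , refl , AQ₄-cubelike
GAQ-cubelike (gaqS g₁ g₂ M₁ M₂ perfect₁ perfect₂ disjoint) with GAQ-cubelike g₁ | GAQ-cubelike g₂
... | j , refl , cube₁ | _ , refl , cube₂ = suc j , refl ,
  cubelike (m≤m+n 7 (j * 2)) cube₁ cube₂ c-rows c-columns
  where open Step M₁ M₂ perfect₁ perfect₂ disjoint

-- Isolating sets, and the criterion for being super matched.

isolated? : ∀ {G} (F : DelSet G) → Dec (HasIsolated F)
isolated? F = any? λ v → (alive F v ≟ᵇ true) ×-dec all? λ u → edgeH F u v ≟ᵇ false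

isolate : (G : Graph) → Fin (N G) → DelSet G
isolate G v = record { vdel = λ u → adj G u v ; edel = λ _ _ → false }

size-isolate : (G : Graph) (v : Fin (N G)) → size (isolate G v) ≡ degree G v
size-isolate G v = trans (cong (degree G v +_) (begin
  upper (edgeInF (isolate G v))           ≡⟨ sumℕ-cong (λ a → trans (count-cong λ b →
      trans (cong (⌊ a <? b ⌋ ∧_) (∧-zeroʳ (adj G a b))) (∧-zeroʳ ⌊ a <? b ⌋)) (count-false {N G})) ⟩
  sumℕ {N G} (λ _ → 0)                    ≡⟨ zeros (N G) ⟩
  0                                       ∎)) (+-identityʳ _)
  where
  open ≡-Reasoning
  zeros : ∀ n → sumℕ {n} (λ _ → 0) ≡ 0
  zeros zero    = refl
  zeros (suc n) = zeros n

isolated⇒FSMP : ∀ {G} (F : DelSet G) → HasIsolated F → IsFSMPSet G F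
isolated⇒FSMP F (v , v∈ , isolated) fpm = contradiction
  (trans (sym (sumℚ-0 (λ u → f u v) (λ u → f-sup u v (isolated u)))) (f-sum v v∈)) λ ()
  where open FracPerfectMatching fpm

isolate-isolates : (G : Graph) (v : Fin (N G)) → HasIsolated (isolate G v)
isolate-isolates G v = v , cong not (adj-irr G v) , λ u → ¬-not λ e →
  not-true⁻ (edgeH-aliveˡ (isolate G v) {u} {v} e) (edgeH-adj (isolate G v) {u} {v} e)

-- Deleting all neighbours of a vertex gives an FSMP set of size `d`. A smaller set isolates nothing
-- by `degree-faults`, so `matched` excludes it and the minimum is `d`. An optimal set has size at
-- most `d`, so it isolates a vertex; decidability of isolation removes the double negation.
super-matched : ∀ {G} → Cubelike d G →
  (∀ F → size F ≤ d → ¬ HasIsolated F → ¬ ¬ FracPerfectMatching F) → FractionalStronglySuperMatched G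
super-matched {d} {G} cube matched =
    ((isolate G v₀ , fsmp₀ , trans size₀ (sym (δ-cubelike cube))) ,
      λ F fsmp → subst (_≤ size F) (sym (δ-cubelike cube)) (lower F fsmp))
  , λ F (fsmp , optimal) → decidable-stable (isolated? F) λ none →
      matched F (subst (size F ≤_) size₀ (optimal (isolate G v₀) fsmp₀)) none fsmp
  where
  open Cubelike cube
  v₀ : Fin (N G)
  v₀ = fromℕ< nonempty
  size₀ : size (isolate G v₀) ≡ d
  size₀ = trans (size-isolate G v₀) (regular v₀)
  fsmp₀ : IsFSMPSet G (isolate G v₀)
  fsmp₀ = isolated⇒FSMP (isolate G v₀) (isolate-isolates G v₀)
  lower : ∀ F → IsFSMPSet G F → d ≤ size F
  lower F fsmp = decidable-stable (d ≤? size F) λ d≰ → matched F (<⇒≤ (≰⇒> d≰))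
    (λ (v , v∈ , isolated) → d≰ (subst (_≤ size F) (regular v) (degree-faults F v∈ isolated))) fsmp

theorem3p6 : (n : ℕ) → 5 ≤ n
    → (∀ G → GAQ (n ∸ 1) G → EvenStronglySuperMatched G)
    → (∀ G → GAQ (n ∸ 1) G → FractionalStronglySuperMatched G)
    → ∀ G → GAQ n G → FractionalStronglySuperMatched G
theorem3p6 .4 (s≤s (s≤s (s≤s (s≤s ())))) _ _ _ gaq4
theorem3p6 (suc n) _ _ super _ (gaqS {G₁ = G₁} {G₂} g₁ g₂ M₁ M₂ perfect₁ perfect₂ disjoint)
  with GAQ-cubelike g₁ | GAQ-cubelike g₂
... | j , refl , cube₁ | _ , refl , cube₂ = super-matched
  (cubelike 7≤d cube₁ cube₂ c-rows c-columns)
  -- `M₁` serves as the cross matching of `crossing`; `M₂` enters through the valency and the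
  -- codegrees of the join.
  λ F few none → hall⇒fpm F (hall-independent F (independent-expands F 7≤d cube₁ cube₂
    (resilient cube₁ (proj₁ (super G₁ g₁))) (resilient cube₂ (proj₁ (super G₂ g₂)))
    M₁ (∨-trueˡ _) perfect₁ few none))
  where
  open Step M₁ M₂ perfect₁ perfect₂ disjoint
  7≤d = m≤m+n 7 (j * 2)
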